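{- Let $G$ be a finite nonnilpotent group and let $\alpha$ be a faithful action of $G$ on a finite set $S$. Let $G^0=G\cup\{0\}$ and $S^0=S\cup\{0\}$ (each with a new element $0$), and define $\alpha^0:G^0\times S^0\to S^0$ by $\alpha^0(g,x)=gx$ if $g\in G$, $x\in S$, and $\alpha^0(g,x)=0$ otherwise. Let $\mathbf{C}$ be the algebra with universe $G^0\times S^0$ and two basic operations: a unary operation $f((g,x))=(g,\alpha^0(g,x))$ and a binary operation $d((g_1,x_1),(g_2,x_2))=(g_1,x_2)$. Then $\mathbf{C}$ is inherently nonfinitely based in the finite sense: for every $n\geq 1$ there exists $d\geq 1$ such that $\mathscr{V}(\mathbf{C})^{(n)}$ contains arbitrarily large finite $d$-generated algebras.
   Context: For a finite algebra $\mathbf{A}$ (with finitely many basic operations) and $n\geq 1$, $\mathscr{V}(\mathbf{A})^{(n)}$ denotes the class of all algebras (in the same signature) satisfying every identity in at most $n$ variables that is valid in $\mathbf{A}$. "Arbitrarily large finite $d$-generated algebras" means: for every $\ell>0$ there is a finite algebra in the class, generated by at most $d$ elements, with at least $\ell$ elements. (In the paper $\mathbf{C}$ is denoted $\mathbb{A}_0(G,S,\alpha)^\ast$.) -}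

module Defs where

open import Data.Nat using (ℕ; zero; suc; _≤_)
open import Data.Fin using (Fin)
open import Data.Maybe using (Maybe; just; nothing)
open import Data.Product using (Σ; ∃; _×_; _,_)
open import Relation.Binary.PropositionalEquality using (_≡_)
open import Relation.Nullary using (¬_)

-- Finite groups, presented (up to isomorphism) on the carrier Fin m.

record FinGroup (m : ℕ) : Set where
  field
    e      : Fin m
    _·_    : Fin m → Fin m → Fin m
    inv    : Fin m → Fin m
    assoc  : ∀ x y z → (x · y) · z ≡ x · (y · z)
    idˡ    : ∀ x → e · x ≡ x
    idʳ    : ∀ x → x · e ≡ x
    invˡ   : ∀ x → inv x · x ≡ e
    invʳ   : ∀ x → x · inv x ≡ e

  comm : Fin m → Fin m → Fin m
  comm x y = ((inv x · inv y) · x) · y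

  Zeta : ℕ → Fin m → Set
  Zeta zero    x = x ≡ e
  Zeta (suc i) x = ∀ y → Zeta i (comm x y)

  Nilpotent : Set
  Nilpotent = ∃ λ c → ∀ x → Zeta c x

record FaithfulAction {m : ℕ} (G : FinGroup m) (k : ℕ) : Set where
  open FinGroup G
  field
    act      : Fin m → Fin k → Fin k
    act-id   : ∀ x → act e x ≡ x
    act-comp : ∀ g h x → act (g · h) x ≡ act g (act h x)
    faithful : ∀ g h → (∀ x → act g x ≡ act h x) → g ≡ h

record Algebra : Set₁ where
  field
    Carrier : Set
    f       : Carrier → Carrier
    d       : Carrier → Carrier → Carrier

data Term (n : ℕ) : Set where
  var : Fin n → Term n
  f′  : Term n → Term n
  d′  : Term n → Term n → Term n

eval : (A : Algebra) {n : ℕ} → (Fin n → Algebra.Carrier A) → Term n → Algebra.Carrier A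
eval A ρ (var i)  = ρ i
eval A ρ (f′ t)   = Algebra.f A (eval A ρ t)
eval A ρ (d′ s t) = Algebra.d A (eval A ρ s) (eval A ρ t)

_⊨_≈_ : (A : Algebra) {n : ℕ} → Term n → Term n → Set
A ⊨ s ≈ t = ∀ ρ → eval A ρ s ≡ eval A ρ t

InVn : ℕ → Algebra → Algebra → Set
InVn n A B = (s t : Term n) → A ⊨ s ≈ t → B ⊨ s ≈ t

GeneratedBy : (B : Algebra) {d : ℕ} → (Fin d → Algebra.Carrier B) → Set₁
GeneratedBy B gens =
  (P : Algebra.Carrier B → Set) →
  (∀ i → P (gens i)) →
  (∀ x → P x → P (Algebra.f B x)) →
  (∀ x y → P x → P y → P (Algebra.d B x y)) →
  ∀ b → P b

-- Finite algebras with carrier Fin N (every finite algebra is isomorphic to one such)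
finAlg : (N : ℕ) → (Fin N → Fin N) → (Fin N → Fin N → Fin N) → Algebra
finAlg N fo dO = record { Carrier = Fin N ; f = fo ; d = dO }

ArbLargeFinGen : ℕ → Algebra → ℕ → Set₁
ArbLargeFinGen n A dd = ∀ (ℓ : ℕ) → Σ ℕ λ N → ℓ ≤ N × (Σ (Fin N → Fin N) λ fo → Σ (Fin N → Fin N → Fin N) λ dO →
   InVn n A (finAlg N fo dO) × Σ (Fin dd → Fin N) λ gens → GeneratedBy (finAlg N fo dO) gens)

-- The algebra C = A₀(G,S,α)*; `nothing` plays the role of the new element 0.

α⁰ : {m k : ℕ} {G : FinGroup m} → FaithfulAction G k → Maybe (Fin m) → Maybe (Fin k) → Maybe (Fin k)
α⁰ α (just g) (just x) = just (FaithfulAction.act α g x)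
α⁰ α (just g) nothing  = nothing
α⁰ α nothing  _        = nothing

algC : {m k : ℕ} (G : FinGroup m) → FaithfulAction G k → Algebra
algC {m} {k} G α = record
  { Carrier = Maybe (Fin m) × Maybe (Fin k)
  ; f = λ { (g , x) → (g , α⁰ α g x) }
  ; d = λ { (g₁ , x₁) (g₂ , x₂) → (g₁ , x₂) }
  }

{-# OPTIONS --safe #-}

-- Terms over C are words acting on a point, so an identity of C amounts to equal
-- outer variables and a semigroup identity w ≈ w′ of G.
--
-- A finite nonnilpotent group has a nontrivial abelian section Z / L with an element t
-- acting on it so that every power of t is trivial or fixed-point-free.  Otherwise all
-- subgroups are nilpotent: in a minimal counterexample H, with N a maximal normal
-- subgroup, distinct maximal subgroups containing N meet in N, and counting conjugates
-- (as in Schmidt's theorem) makes H / N cyclic; the hypercentre of H then absorbs N.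
--
-- Let t have order 2 + k on Z / L and let a in Z / L have order 2 + h.  The model has
-- letters c, q₁, …, qₙ acting on D × (ℤ/(2 + k))ⁿ: qᵢ increments the i-th counter, and c
-- acts on D by x when all counters are 0, by y when they are all 1, and trivially
-- otherwise, where x and y have order 2 + h and generate a transitive group on the
-- arbitrarily large set D.
-- Substituting c ↦ a, qᵢ ↦ t^eᵢ into w ≈ w′ equates ∑ τ^(e·s) a over the states s at
-- which c occurs (τ being conjugation by t), and multiplying by factors τ^(sᵢ) − τ^v isolates a single state.
-- As n variables miss one of the n + 1 letters, x and y never interact.

module Submission where

open import Defs
open import Algebra.Bundles using (AbelianGroup)
open import Data.Bool using (Bool; true; false; not; _∧_)
open import Data.Bool.Properties using () renaming (_≟_ to _≟ᵇ_)
open import Data.Empty using (⊥; ⊥-elim)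
open import Data.Fin using (Fin; zero; suc; toℕ; fromℕ; fromℕ<; inject₁)
open import Data.Fin.Induction using (<-weakInduction)
open import Data.Fin.Patterns using (0F; 1F; 2F; 3F)
open import Data.Fin.Permutation using (permutation)
import Data.Fin.Properties as Fin
open import Data.Fin.Relation.Unary.Top using (view; view-fromℕ; view-inject₁; ‵fromℕ; ‵inject₁)
open import Data.Fin.Subset.Properties using (anySubset?)
open import Data.List using (List; []; _∷_; foldr; map; filter; cartesianProduct; allFin; upTo)
open import Data.List.Membership.Propositional using () renaming (_∈_ to _∈ᴸ_; _∉_ to _∉ᴸ_)
open import Data.List.Membership.Propositional.Properties using (∈-map⁻; ∈-filter⁺; ∈-filter⁻; ∈-cartesianProduct⁺; ∈-cartesianProduct⁻; ∈-allFin; ∈-upTo⁺; ∈-upTo⁻)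
open import Data.List.Relation.Unary.Any using (here; there)
open import Data.Maybe using (Maybe; just; nothing)
open import Data.Maybe.Properties using (just-injective)
open import Data.Nat using (ℕ; zero; suc; _+_; _*_; _∸_; _≤_; _<_; z≤n; s≤s; _%_; _/_; NonZero; >-nonZero; _≤′_; ≤′-refl; ≤′-step) renaming (_^_ to _^ℕ_)
open import Data.Nat.DivMod using (_mod_; m≡m%n+[m/n]*n; m%n<n; %-distribˡ-+; m%n%n≡m%n; m<n⇒m%n≡m; [m+n]%n≡m%n)
open import Data.Nat.ListAction using () renaming (sum to sumᴸ)
open import Data.Nat.Properties
open import Data.Nat.Solver using (module +-*-Solver)
open import Data.Product using (Σ; ∃; _×_; _,_; proj₁; proj₂)
open import Data.Product.Function.NonDependent.Propositional using (_×-↔_)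
open import Data.Sum using (_⊎_; inj₁; inj₂)
open import Data.Vec using (Vec; []; _∷_; lookup; tabulate; updateAt; _[_]≔_; replicate; head; tail)
open import Data.Vec.Properties using (lookup∘tabulate; lookup∘updateAt; lookup∘updateAt′; lookup-replicate; updateAt-updateAt; updateAt-id-local)
open import Function using (_∘_; _∘₂_; _↔_; mk↔ₛ′; Inverse)
open import Function.Properties.Inverse using (↔-refl; ↔-sym; ↔-trans)
open import Level using (0ℓ)
open import Relation.Binary.Definitions using (tri<; tri≈; tri>)
open import Relation.Binary.PropositionalEquality as ≡ using (_≡_; cong; subst)
open import Relation.Nullary using (¬_; Dec; yes; no)
open import Relation.Nullary.Decidable using (decidable-stable; map′; _×-dec_; _⊎-dec_; _→-dec_; ¬?)
open import Algebra.Properties.CommutativeMonoid.Sum +-0-commutativeMonoid using (sum; sum-cong-≗; ∑-distrib-+; ∑-comm; sum-permute)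
open import Algebra.Properties.CommutativeSemigroup +-commutativeSemigroup using (x∙yz≈y∙xz)

-- Two demands on the model pull apart. It has to be generated from one starting state however large
-- D is, so words in all letters must realise both x and y. Yet in any n of the letters only powers
-- of one permutation of order 2 + h may be visible, since the identities of G are only shown to
-- control such powers. The counters act as a lock: passing from the state 0 ... 0, where x is
-- available, to 1 ... 1, where y is, takes every qᵢ. Without qᵢ its counter is frozen and at most
-- one of x and y ever acts; without c neither does. Writing the orders as 2 + k and 2 + h records
-- that both are at least 2. The first keeps the residues 0 and 1 apart, the second lets y carry
-- from one column of D to the next. The group theory runs under double negation, because
-- hypercentres, normalisers and maximal subgroups are used there without being computed.

power : {A : Set} → (A → A) → ℕ → A → A
power f zero    x = x
power f (suc n) x = f (power f n x)

-- Isolating the states of a word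

-- Words over the letters c = zero and q i = suc i; a word is read from right to
-- left, q i increments the i-th counter and c leaves the counters unchanged.
module _ {r : ℕ} where

  Counters : Set
  Counters = Fin r → ℕ

  bump : Fin r → Counters → Counters
  bump i σ j with i Fin.≟ j
  ... | yes _ = suc (σ j)
  ... | no _  = σ j

  run : List (Fin (suc r)) → Counters → Counters
  run []          σ = σ
  run (zero ∷ W)  σ = run W σ
  run (suc i ∷ W) σ = bump i (run W σ)

  Matches : (k u : ℕ) .{{_ : NonZero k}} → Counters → Set
  Matches k u σ = ∀ i → σ i % k ≡ u

  matches? : ∀ k u .{{_ : NonZero k}} σ → Dec (Matches k u σ)
  matches? k u σ = Fin.all? (λ i → σ i % k ≟ u)

  hits : (k u : ℕ) .{{_ : NonZero k}} → List (Fin (suc r)) → Counters → ℕ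
  hits k u []          σ = 0
  hits k u (zero ∷ W)  σ with matches? k u (run W σ)
  ... | yes _ = suc (hits k u W σ)
  ... | no _  = hits k u W σ
  hits k u (suc _ ∷ W) σ = hits k u W σ

  -- The list `es` stands for the exponent vector e of the substitution qᵢ ↦ t^eᵢ: the counter i is
  -- listed eᵢ times. A further factor τ^(σ i) is then just `i ∷ es`.
  dot : List (Fin r) → Counters → ℕ
  dot es σ = sumᴸ (map σ es)

module Isolation (A : AbelianGroup 0ℓ 0ℓ) (τ : AbelianGroup.Carrier A → AbelianGroup.Carrier A)
  (τ-cong : ∀ {x y} → AbelianGroup._≈_ A x y → AbelianGroup._≈_ A (τ x) (τ y))
  (τ-⊕ : ∀ x y → AbelianGroup._≈_ A (τ (AbelianGroup._∙_ A x y)) (AbelianGroup._∙_ A (τ x) (τ y))) where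

  open AbelianGroup A renaming (_∙_ to _⊕_; ε to 0#; _⁻¹ to ⊖_; ∙-cong to ⊕-cong)

  open import Algebra.Properties.AbelianGroup A
  open import Algebra.Properties.CommutativeMonoid.Mult commutativeMonoid renaming (_×_ to _·_)
  open import Relation.Binary.Reasoning.Setoid setoid

  iter : ℕ → Carrier → Carrier
  iter = power τ

  iter-cong : ∀ n {x y} → x ≈ y → iter n x ≈ iter n y
  iter-cong zero    h = h
  iter-cong (suc n) h = τ-cong (iter-cong n h)

  iter-⊕ : ∀ n x y → iter n (x ⊕ y) ≈ iter n x ⊕ iter n y
  iter-⊕ zero    x y = refl
  iter-⊕ (suc n) x y = trans (τ-cong (iter-⊕ n x y)) (τ-⊕ _ _)

  iter-0 : ∀ n → iter n 0# ≈ 0#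
  iter-0 n = identityˡ-unique (iter n 0#) (iter n 0#)
    (trans (sym (iter-⊕ n 0# 0#)) (iter-cong n (identityˡ 0#)))

  iter-⊖ : ∀ n x → iter n (⊖ x) ≈ ⊖ iter n x
  iter-⊖ n x = inverseˡ-unique (iter n (⊖ x)) (iter n x)
    (trans (sym (iter-⊕ n (⊖ x) x)) (trans (iter-cong n (inverseˡ x)) (iter-0 n)))

  iter-+ : ∀ m n x → iter (m + n) x ≡ iter m (iter n x)
  iter-+ zero    n x = ≡.refl
  iter-+ (suc m) n x = cong τ (iter-+ m n x)

  iter-comm : ∀ m n x → iter m (iter n x) ≡ iter n (iter m x)
  iter-comm m n x = ≡.trans (≡.sym (iter-+ m n x)) (≡.trans (cong (λ j → iter j x) (+-comm m n)) (iter-+ n m x))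

  iter-· : ∀ n p x → iter n (p · x) ≈ p · iter n x
  iter-· n zero    x = iter-0 n
  iter-· n (suc p) x = trans (iter-⊕ n x (p · x)) (⊕-cong refl (iter-· n p x))

  module _ (k₁ : ℕ) (period : ∀ x → iter (suc k₁) x ≈ x)
    (free : ∀ i → 0 < i → i < suc k₁ → ∀ x → iter i x ≈ x → x ≈ 0#) where

    private
      k : ℕ
      k = suc k₁

    iter-*k : ∀ q x → iter (q * k) x ≈ x
    iter-*k zero    x = refl
    iter-*k (suc q) x = trans (reflexive (iter-+ k (q * k) x)) (trans (period _) (iter-*k q x))

    iter-% : ∀ n x → iter n x ≈ iter (n % k) x
    iter-% n x = begin
      iter n x                          ≡⟨ cong (λ j → iter j x) (m≡m%n+[m/n]*n n k) ⟩
      iter (n % k + (n / k) * k) x      ≡⟨ iter-+ (n % k) ((n / k) * k) x ⟩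
      iter (n % k) (iter (n / k * k) x) ≈⟨ iter-cong (n % k) (iter-*k (n / k) x) ⟩
      iter (n % k) x                    ∎

    iter-injective : ∀ {i} → i ≤ k → ∀ {x y} → iter i x ≈ iter i y → x ≈ y
    iter-injective {i} le {x} {y} h = begin
      x                       ≈⟨ undo x ⟨
      iter (k ∸ i) (iter i x) ≈⟨ iter-cong (k ∸ i) h ⟩
      iter (k ∸ i) (iter i y) ≈⟨ undo y ⟩
      y                       ∎
      where
      undo : ∀ x → iter (k ∸ i) (iter i x) ≈ x
      undo x = trans (reflexive (≡.trans (≡.sym (iter-+ (k ∸ i) i x)) (cong (λ j → iter j x) (m∸n+n≡m le)))) (period x)

    free-< : ∀ {i j} → i < j → j < k → ∀ {x} → iter i x ≈ iter j x → x ≈ 0#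
    free-< {i} {j} i<j j<k {x} h = free (j ∸ i) (m<n⇒0<n∸m i<j) (≤-<-trans (m∸n≤m j i) j<k) x
      (sym (iter-injective (<⇒≤ (<-trans i<j j<k)) (trans h (reflexive
        (≡.trans (cong (λ n → iter n x) (≡.sym (m+[n∸m]≡n (<⇒≤ i<j)))) (iter-+ i (j ∸ i) x))))))

    free-≢ : ∀ {i j x} → ¬ (i % k ≡ j % k) → iter i x ≈ iter j x → x ≈ 0#
    free-≢ {i} {j} {x} ne h with <-cmp (i % k) (j % k)
    ... | tri< lt _ _ = free-< lt (m%n<n j k) (trans (sym (iter-% i x)) (trans h (iter-% j x)))
    ... | tri≈ _ eq _ = ⊥-elim (ne eq)
    ... | tri> _ _ gt = free-< gt (m%n<n i k) (trans (sym (iter-% j x)) (trans (sym h) (iter-% i x)))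

    orbit-period : ∀ {i j x} → iter i x ≈ iter j x → ¬ (x ≈ 0#) → i % k ≡ j % k
    orbit-period {i} {j} h x≉0 with i % k ≟ j % k
    ... | yes eq = eq
    ... | no ne  = ⊥-elim (x≉0 (free-≢ {i} {j} ne h))

    module _ {r : ℕ} (a : Carrier) where

      total : (Counters {r} → Carrier) → List (Fin (suc r)) → Counters → Carrier
      total ψ []          σ = 0#
      total ψ (zero ∷ W)  σ = ψ (run W σ) ⊕ total ψ W σ
      total ψ (suc _ ∷ W) σ = total ψ W σ

      -- ψ es ps σ = τ^(es ∙ σ) ∏_{(i , v) ∈ ps} (τ^(σ i) − τ^v) a
      ψ : List (Fin r) → List (Fin r × ℕ) → Counters → Carrier
      ψ es []             σ = iter (dot es σ) a
      ψ es ((i , v) ∷ ps) σ = ψ (i ∷ es) ps σ ⊕ ⊖ iter v (ψ es ps σ)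

      total-⊕⊖ : ∀ (f g : Counters → Carrier) v W σ →
        total (λ σ → f σ ⊕ ⊖ iter v (g σ)) W σ ≈ total f W σ ⊕ ⊖ iter v (total g W σ)
      total-⊕⊖ f g v [] σ = begin
        0#                  ≈⟨ inverseʳ (iter v 0#) ⟨
        iter v 0# ⊕ ⊖ iter v 0# ≈⟨ ⊕-cong (iter-0 v) refl ⟩
        0# ⊕ ⊖ iter v 0#    ∎
      total-⊕⊖ f g v (suc _ ∷ W) σ = total-⊕⊖ f g v W σ
      total-⊕⊖ f g v (zero ∷ W) σ = begin
        (x ⊕ ⊖ iter v y) ⊕ total (λ σ → f σ ⊕ ⊖ iter v (g σ)) W σ ≈⟨ ⊕-cong refl (total-⊕⊖ f g v W σ) ⟩
        (x ⊕ ⊖ iter v y) ⊕ (X ⊕ ⊖ iter v Y) ≈⟨ interchange x (⊖ iter v y) X (⊖ iter v Y) ⟩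
        (x ⊕ X) ⊕ (⊖ iter v y ⊕ ⊖ iter v Y) ≈⟨ ⊕-cong refl (⁻¹-∙-comm (iter v y) (iter v Y)) ⟩
        (x ⊕ X) ⊕ ⊖ (iter v y ⊕ iter v Y)   ≈⟨ ⊕-cong refl (⁻¹-cong (iter-⊕ v y Y)) ⟨
        (x ⊕ X) ⊕ ⊖ iter v (y ⊕ Y)          ∎
        where
        open import Algebra.Properties.CommutativeSemigroup (AbelianGroup.commutativeSemigroup A) using (interchange)
        x = f (run W σ)
        y = g (run W σ)
        X = total f W σ
        Y = total g W σ

      ψ-∷ : ∀ i es ps σ → ψ (i ∷ es) ps σ ≈ iter (σ i) (ψ es ps σ)
      ψ-∷ i es [] σ = reflexive (iter-+ (σ i) (dot es σ) a)
      ψ-∷ i es ((j , v) ∷ ps) σ = begin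
        ψ (j ∷ i ∷ es) ps σ ⊕ ⊖ iter v (ψ (i ∷ es) ps σ)
          ≈⟨ ⊕-cong (ψ-∷ j (i ∷ es) ps σ) (⁻¹-cong (iter-cong v (ψ-∷ i es ps σ))) ⟩
        iter (σ j) (ψ (i ∷ es) ps σ) ⊕ ⊖ iter v (iter (σ i) (ψ es ps σ))
          ≈⟨ ⊕-cong (iter-cong (σ j) (ψ-∷ i es ps σ)) (⁻¹-cong (reflexive (iter-comm v (σ i) _))) ⟩
        iter (σ j) (iter (σ i) (ψ es ps σ)) ⊕ ⊖ iter (σ i) (iter v (ψ es ps σ))
          ≈⟨ ⊕-cong (reflexive (iter-comm (σ j) (σ i) _)) (sym (iter-⊖ (σ i) _)) ⟩
        iter (σ i) (iter (σ j) (ψ es ps σ)) ⊕ iter (σ i) (⊖ iter v (ψ es ps σ))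
          ≈⟨ iter-⊕ (σ i) _ _ ⟨
        iter (σ i) (iter (σ j) (ψ es ps σ) ⊕ ⊖ iter v (ψ es ps σ))
          ≈⟨ iter-cong (σ i) (⊕-cong (ψ-∷ j es ps σ) refl) ⟨
        iter (σ i) (ψ (j ∷ es) ps σ ⊕ ⊖ iter v (ψ es ps σ)) ∎

      ψ-vanishes : ∀ {i v} ps σ → (i , v) ∈ᴸ ps → σ i % k ≡ v % k → ψ [] ps σ ≈ 0#
      ψ-vanishes {i} {v} ((i , v) ∷ ps) σ (here ≡.refl) h = begin
        ψ (i ∷ []) ps σ ⊕ ⊖ iter v (ψ [] ps σ)       ≈⟨ ⊕-cong (ψ-∷ i [] ps σ) refl ⟩
        iter (σ i) (ψ [] ps σ) ⊕ ⊖ iter v (ψ [] ps σ) ≈⟨ ⊕-cong (iter-% (σ i) _) refl ⟩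
        iter (σ i % k) (ψ [] ps σ) ⊕ ⊖ iter v (ψ [] ps σ) ≡⟨ cong (λ n → iter n (ψ [] ps σ) ⊕ ⊖ iter v (ψ [] ps σ)) h ⟩
        iter (v % k) (ψ [] ps σ) ⊕ ⊖ iter v (ψ [] ps σ) ≈⟨ ⊕-cong (iter-% v _) refl ⟨
        iter v (ψ [] ps σ) ⊕ ⊖ iter v (ψ [] ps σ) ≈⟨ inverseʳ _ ⟩
        0# ∎
      ψ-vanishes {i} {v} ((j , w) ∷ ps) σ (there p) h = begin
        ψ (j ∷ []) ps σ ⊕ ⊖ iter w (ψ [] ps σ)       ≈⟨ ⊕-cong (ψ-∷ j [] ps σ) refl ⟩
        iter (σ j) (ψ [] ps σ) ⊕ ⊖ iter w (ψ [] ps σ) ≈⟨ ⊕-cong (iter-cong (σ j) IH) (⁻¹-cong (iter-cong w IH)) ⟩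
        iter (σ j) 0# ⊕ ⊖ iter w 0# ≈⟨ ⊕-cong (iter-0 (σ j)) (⁻¹-cong (iter-0 w)) ⟩
        0# ⊕ ⊖ 0# ≈⟨ inverseʳ 0# ⟩
        0# ∎
        where IH = ψ-vanishes ps σ p h

      -- The product ∏ (τ^u - τ^v) a over the pairs of `ps`, to which `ψ` specialises when every
      -- counter is u.
      leading : ℕ → List (Fin r × ℕ) → Carrier
      leading u []             = a
      leading u ((i , v) ∷ ps) = iter u (leading u ps) ⊕ ⊖ iter v (leading u ps)

      ψ-leading : ∀ u ps σ → Matches k u σ → ψ [] ps σ ≈ leading u ps
      ψ-leading u []             σ h = refl
      ψ-leading u ((i , v) ∷ ps) σ h = ⊕-cong
        (begin
          ψ (i ∷ []) ps σ          ≈⟨ ψ-∷ i [] ps σ ⟩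
          iter (σ i) (ψ [] ps σ)   ≈⟨ iter-% (σ i) _ ⟩
          iter (σ i % k) (ψ [] ps σ) ≡⟨ cong (λ n → iter n (ψ [] ps σ)) (h i) ⟩
          iter u (ψ [] ps σ)       ≈⟨ iter-cong u (ψ-leading u ps σ h) ⟩
          iter u (leading u ps)    ∎)
        (⁻¹-cong (iter-cong v (ψ-leading u ps σ h)))

      -- For u and v in different residue classes τ^u - τ^v is injective, because anything it kills
      -- is fixed by a power of τ with exponent strictly between 0 and k. The factors can therefore
      -- be stripped off one at a time.
      leading-injective : ∀ u ps → (∀ {i v} → (i , v) ∈ᴸ ps → ¬ (u % k ≡ v % k)) →
        ∀ p q → p · leading u ps ≈ q · leading u ps → p · a ≈ q · a
      leading-injective u []             ne p q h = h
      leading-injective u ((i , v) ∷ ps) ne p q h = leading-injective u ps (ne ∘ there) p q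
        (x∙y⁻¹≈ε⇒x≈y _ _ (free-≢ {u} {v} (ne (here ≡.refl)) (begin
          iter u (p · c ⊕ ⊖ (q · c))                ≈⟨ expand u ⟩
          (p · iter u c) ⊕ ⊖ (q · iter u c)         ≈⟨ rearrange ⟩
          (p · iter v c) ⊕ ⊖ (q · iter v c)         ≈⟨ expand v ⟨
          iter v (p · c ⊕ ⊖ (q · c))                ∎)))
        where
        c = leading u ps
        U = iter u c
        V = iter v c
        expand : ∀ n → iter n (p · c ⊕ ⊖ (q · c)) ≈ (p · iter n c) ⊕ ⊖ (q · iter n c)
        expand n = trans (iter-⊕ n _ _) (⊕-cong (iter-· n p c) (trans (iter-⊖ n _) (⁻¹-cong (iter-· n q c))))
        ·-⊖ : ∀ p x → p · (⊖ x) ≈ ⊖ (p · x)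
        ·-⊖ p x = inverseˡ-unique (p · (⊖ x)) (p · x)
          (trans (sym (×-distrib-+ (⊖ x) x p)) (trans (×-congʳ p (inverseˡ x)) (zero-· p)))
          where
          zero-· : ∀ p → p · 0# ≈ 0#
          zero-· zero    = refl
          zero-· (suc p) = trans (identityˡ _) (zero-· p)
        split : ∀ p → p · (U ⊕ ⊖ V) ≈ (p · U) ⊕ ⊖ (p · V)
        split p = trans (×-distrib-+ U (⊖ V) p) (⊕-cong refl (·-⊖ p V))
        rearrange : (p · U) ⊕ ⊖ (q · U) ≈ (p · V) ⊕ ⊖ (q · V)
        rearrange = begin
          pU ⊕ ⊖ qU                         ≈⟨ ⊕-cong (sym (identityʳ pU)) refl ⟩
          (pU ⊕ 0#) ⊕ ⊖ qU                  ≈⟨ ⊕-cong (⊕-cong refl (sym (inverseˡ pV))) refl ⟩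
          (pU ⊕ (⊖ pV ⊕ pV)) ⊕ ⊖ qU         ≈⟨ ⊕-cong (sym (assoc _ _ _)) refl ⟩
          ((pU ⊕ ⊖ pV) ⊕ pV) ⊕ ⊖ qU         ≈⟨ ⊕-cong (⊕-cong (trans (sym (split p)) (trans h (split q))) refl) refl ⟩
          ((qU ⊕ ⊖ qV) ⊕ pV) ⊕ ⊖ qU         ≈⟨ ⊕-cong (trans (comm _ _) (⊕-cong refl (comm _ _))) refl ⟩
          (pV ⊕ (⊖ qV ⊕ qU)) ⊕ ⊖ qU         ≈⟨ ⊕-cong (sym (assoc _ _ _)) refl ⟩
          ((pV ⊕ ⊖ qV) ⊕ qU) ⊕ ⊖ qU         ≈⟨ assoc _ _ _ ⟩
          (pV ⊕ ⊖ qV) ⊕ (qU ⊕ ⊖ qU)         ≈⟨ ⊕-cong refl (inverseʳ qU) ⟩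
          (pV ⊕ ⊖ qV) ⊕ 0#                  ≈⟨ identityʳ _ ⟩
          pV ⊕ ⊖ qV                         ∎
          where
          pU = p · U
          qU = q · U
          pV = p · V
          qV = q · V

      -- Enough factors to make `ψ` vanish at every state that is not constantly u: some counter i
      -- has a residue v other than u there, and `(i , v)` is listed.
      others : ℕ → List (Fin r × ℕ)
      others u = filter (λ z → ¬? (proj₂ z ≟ u)) (cartesianProduct (allFin r) (upTo k))

      total-hits : ∀ u → u < k → ∀ W σ → total (ψ [] (others u)) W σ ≈ hits k u W σ · leading u (others u)
      total-hits u u<k []          σ = refl
      total-hits u u<k (suc _ ∷ W) σ = total-hits u u<k W σ
      total-hits u u<k (zero ∷ W)  σ with matches? k u (run W σ)
      ... | yes h = ⊕-cong (ψ-leading u (others u) (run W σ) h) (total-hits u u<k W σ)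
      ... | no ¬h = trans (⊕-cong zero-value (total-hits u u<k W σ)) (identityˡ _)
        where
        zero-value : ψ [] (others u) (run W σ) ≈ 0#
        zero-value with Fin.¬∀⟶∃¬ r _ (λ i → run W σ i % k ≟ u) ¬h
        ... | i , ne = ψ-vanishes (others u) (run W σ)
          (∈-filter⁺ (λ z → ¬? (proj₂ z ≟ u)) (∈-cartesianProduct⁺ (∈-allFin i) (∈-upTo⁺ (m%n<n (run W σ i) k))) ne)
          (≡.sym (m%n%n≡m%n (run W σ i) k))

      -- Expanding the product writes `ψ [] (others u)` as a combination of the `ψ es []` with
      -- operators ±τ^v that do not depend on the state. Totals that agree for all exponent vectors
      -- therefore agree for it too, and there only the hits contribute.
      hits-determined : ∀ u → u < k → ∀ W W′ σ →
        (∀ es → total (ψ es []) W σ ≈ total (ψ es []) W′ σ) → hits k u W σ · a ≈ hits k u W′ σ · a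
      hits-determined u u<k W W′ σ h = leading-injective u (others u) ne (hits k u W σ) (hits k u W′ σ)
        (trans (sym (total-hits u u<k W σ)) (trans (all-ψ (others u) []) (total-hits u u<k W′ σ)))
        where
        all-ψ : ∀ ps es → total (ψ es ps) W σ ≈ total (ψ es ps) W′ σ
        all-ψ []             es = h es
        all-ψ ((i , v) ∷ ps) es = trans (total-⊕⊖ (ψ (i ∷ es) ps) (ψ es ps) v W σ)
          (trans (⊕-cong (all-ψ ps (i ∷ es)) (⁻¹-cong (iter-cong v (all-ψ ps es))))
            (sym (total-⊕⊖ (ψ (i ∷ es) ps) (ψ es ps) v W′ σ)))
        ne : ∀ {i v} → (i , v) ∈ᴸ others u → ¬ (u % k ≡ v % k)
        ne {i} {v} p eq with ∈-filter⁻ (λ z → ¬? (proj₂ z ≟ u)) {xs = cartesianProduct (allFin r) (upTo k)} p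
        ... | q , v≢u = v≢u (≡.sym (≡.trans (≡.sym (m<n⇒m%n≡m u<k))
          (≡.trans eq (m<n⇒m%n≡m (∈-upTo⁻ (proj₂ (∈-cartesianProduct⁻ (allFin r) (upTo k) q)))))))

open ≡ using (refl; sym; trans; cong₂; subst₂; module ≡-Reasoning)

-- The models

rot : ∀ {n} → Fin (suc n) → Fin (suc n)
rot {n} i = suc (toℕ i) mod suc n

suc-% : ∀ m n .{{_ : NonZero n}} → suc (m % n) % n ≡ suc m % n
suc-% m n = begin
  (1 + m % n) % n         ≡⟨ %-distribˡ-+ 1 (m % n) n ⟩
  (1 % n + m % n % n) % n ≡⟨ cong (λ z → (1 % n + z) % n) (m%n%n≡m%n m n) ⟩
  (1 % n + m % n) % n     ≡⟨ %-distribˡ-+ 1 m n ⟨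
  (1 + m) % n             ∎
  where open ≡-Reasoning

toℕ-rot : ∀ {n} (i : Fin (suc n)) → toℕ (rot i) ≡ suc (toℕ i) % suc n
toℕ-rot i = Fin.toℕ-fromℕ< (m%n<n (suc (toℕ i)) _)

toℕ-power-rot : ∀ {n} p (i : Fin (suc n)) → toℕ (power rot p i) ≡ (p + toℕ i) % suc n
toℕ-power-rot zero    i = sym (m<n⇒m%n≡m (Fin.toℕ<n i))
toℕ-power-rot {n} (suc p) i = trans (toℕ-rot (power rot p i))
  (trans (cong (λ z → suc z % suc n) (toℕ-power-rot p i)) (suc-% (p + toℕ i) (suc n)))

power-rot-% : ∀ {n} p q → p % suc n ≡ q % suc n → (i : Fin (suc n)) → power rot p i ≡ power rot q i
power-rot-% {n} p q h i = Fin.toℕ-injective (begin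
  toℕ (power rot p i)                    ≡⟨ toℕ-power-rot p i ⟩
  (p + toℕ i) % suc n                    ≡⟨ %-distribˡ-+ p (toℕ i) (suc n) ⟩
  (p % suc n + toℕ i % suc n) % suc n    ≡⟨ cong (λ z → (z + toℕ i % suc n) % suc n) h ⟩
  (q % suc n + toℕ i % suc n) % suc n    ≡⟨ %-distribˡ-+ q (toℕ i) (suc n) ⟨
  (q + toℕ i) % suc n                    ≡⟨ toℕ-power-rot q i ⟨
  toℕ (power rot q i)                    ∎)
  where open ≡-Reasoning

rot-inject₁ : ∀ {n} (i : Fin n) → rot (inject₁ i) ≡ suc i
rot-inject₁ {n} i = Fin.toℕ-injective (trans (toℕ-rot (inject₁ i))
  (trans (cong (λ z → suc z % suc n) (Fin.toℕ-inject₁ i)) (m<n⇒m%n≡m (s≤s (Fin.toℕ<n i)))))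

rot-transitive : ∀ {n} (P : Fin (suc n) → Set) → (∀ i → P i → P (rot i)) → ∀ i → P i → ∀ j → P j
-- `suc n ∸ toℕ i` steps lead from i round to zero and `toℕ j` more lead to j, whichever of the two
-- is larger.
rot-transitive {n} P step i p j = subst P (Fin.toℕ-injective (begin
  toℕ (power rot (toℕ j + (suc n ∸ toℕ i)) i)  ≡⟨ toℕ-power-rot (toℕ j + (suc n ∸ toℕ i)) i ⟩
  (toℕ j + (suc n ∸ toℕ i) + toℕ i) % suc n   ≡⟨ cong (_% suc n) (+-assoc (toℕ j) _ _) ⟩
  (toℕ j + (suc n ∸ toℕ i + toℕ i)) % suc n   ≡⟨ cong (λ z → (toℕ j + z) % suc n) (m∸n+n≡m (<⇒≤ (Fin.toℕ<n i))) ⟩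
  (toℕ j + suc n) % suc n                     ≡⟨ [m+n]%n≡m%n (toℕ j) (suc n) ⟩
  toℕ j % suc n                               ≡⟨ m<n⇒m%n≡m (Fin.toℕ<n j) ⟩
  toℕ j                                       ∎)) (iterate (toℕ j + (suc n ∸ toℕ i)))
  where
  open ≡-Reasoning
  iterate : ∀ q → P (power rot q i)
  iterate zero    = p
  iterate (suc q) = step _ (iterate q)

-- x rotates the columns { j } × Fin (2 + h), and its conjugate y under the odometer
-- links the end of each column to the start of the next.
module Odometer (ℓ h : ℕ) where

  D : Set
  D = Fin (suc ℓ) × Fin (2 + h)

  inc dec : D → D
  inc (j , r) with view r
  ... | ‵fromℕ      = rot j , zero
  ... | ‵inject₁ r′ = j , suc r′
  -- On the `suc ℓ` columns the ℓ-th power of `rot` is its inverse.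
  dec (j , zero)  = power rot ℓ j , fromℕ _
  dec (j , suc r) = j , inject₁ r

  x y : D → D
  x (j , r) = j , rot r
  y δ = inc (x (dec δ))

  dec-inc : ∀ δ → dec (inc δ) ≡ δ
  dec-inc (j , r) with view r
  ... | ‵fromℕ      = cong (_, fromℕ _) (trans (sym (power-+ ℓ 1)) (power-rot-% (ℓ + 1) 0 eq j))
    where
    power-+ : ∀ p q → power rot (p + q) j ≡ power rot p (power rot q j)
    power-+ zero    q = refl
    power-+ (suc p) q = cong rot (power-+ p q)
    eq : (ℓ + 1) % suc ℓ ≡ 0 % suc ℓ
    eq = trans (cong (_% suc ℓ) (+-comm ℓ 1)) ([m+n]%n≡m%n 0 (suc ℓ))
  ... | ‵inject₁ r′ = refl

  inc-dec : ∀ δ → inc (dec δ) ≡ δ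
  inc-dec (j , zero)  rewrite view-fromℕ (suc h) = cong (_, zero) (power-rot-% (suc ℓ) 0 ([m+n]%n≡m%n 0 (suc ℓ)) j)
  inc-dec (j , suc r) rewrite view-inject₁ r = refl

  power-x : ∀ p j r → power x p (j , r) ≡ (j , power rot p r)
  power-x zero    j r = refl
  power-x (suc p) j r = cong x (power-x p j r)

  power-y : ∀ p δ → power y p δ ≡ inc (power x p (dec δ))
  power-y zero    δ = sym (inc-dec δ)
  power-y (suc p) δ = trans (cong y (power-y p δ)) (cong (λ z → inc (x z)) (dec-inc (power x p (dec δ))))

  power-x-% : ∀ p q → p % (2 + h) ≡ q % (2 + h) → ∀ δ → power x p δ ≡ power x q δ
  power-x-% p q eq (j , r) = trans (power-x p j r) (trans (cong (j ,_) (power-rot-% p q eq r)) (sym (power-x q j r)))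

  power-y-% : ∀ p q → p % (2 + h) ≡ q % (2 + h) → ∀ δ → power y p δ ≡ power y q δ
  power-y-% p q eq δ = trans (power-y p δ) (trans (cong inc (power-x-% p q eq (dec δ))) (sym (power-y q δ)))

  transitive : (P : D → Set) → (∀ δ → P δ → P (x δ)) → (∀ δ → P δ → P (y δ)) → P (zero , zero) → ∀ δ → P δ
  transitive P px py p₀ (j , r) = columns j r
    where
    column : ∀ j → P (j , zero) → ∀ r → P (j , r)
    column j p = <-weakInduction (λ r → P (j , r)) p λ r q → subst (λ z → P (j , z)) (rot-inject₁ r) (px _ q)
    -- `dec` steps down from the top row, `x` moves back up to it, and `inc` carries over. This
    -- needs at least two rows.
    carry : ∀ j → y (j , fromℕ (suc h)) ≡ (rot j , zero)
    carry j rewrite rot-inject₁ (fromℕ h) | view-fromℕ h = refl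
    columns : ∀ j r → P (j , r)
    columns = <-weakInduction (λ j → ∀ r → P (j , r)) (column zero p₀) λ j q →
      column (suc j) (subst P (trans (carry (inject₁ j)) (cong (_, zero) (rot-inject₁ j))) (py _ (q (fromℕ (suc h)))))

vec-transitive : ∀ {A : Set} {r} (P : Vec A r → Set) → (∀ i a s → P s → P (s [ i ]≔ a)) → ∀ s → P s → ∀ s′ → P s′
vec-transitive P step []      p []        = p
vec-transitive P step (a ∷ s) p (a′ ∷ s′) = vec-transitive (λ z → P (a′ ∷ z))
  (λ i b z → step (suc i) b (a′ ∷ z)) s (step zero a′ (a ∷ s) p) s′

module Model (r ℓ k h : ℕ) where
  open Odometer ℓ h public

  State : Set
  State = D × Vec (Fin (2 + k)) r

  constant? : ∀ u (s : Vec (Fin (2 + k)) r) → Dec (∀ i → toℕ (lookup s i) ≡ u)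
  constant? u s = Fin.all? λ i → toℕ (lookup s i) ≟ u

  θ : Vec (Fin (2 + k)) r → D → D
  θ s δ with constant? 0 s | constant? 1 s
  ... | yes _ | _     = x δ
  ... | no _  | yes _ = y δ
  ... | no _  | no _  = δ

  act : Fin (suc r) → State → State
  act zero    (δ , s) = θ s δ , s
  act (suc i) (δ , s) = δ , updateAt s i rot

  acts : List (Fin (suc r)) → State → State
  acts W b = foldr act b W

  model : Algebra
  model = record
    { Carrier = Fin (suc r) × State
    ; f = λ { (l , b) → l , act l b }
    ; d = λ { (l , _) (_ , b) → l , b } }

  start : State
  start = (zero , zero) , replicate r zero

  generators : Fin (suc r) → Algebra.Carrier model
  generators l = l , start

  -- `d` attaches every letter to a newly reached state, so it suffices that the letters act
  -- transitively on the states. The counters can be moved without affecting D; setting them all to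
  -- 0 or all to 1 before using c applies x or y. The counter `i₀` makes these two settings
  -- different.
  generated : Fin r → GeneratedBy model generators
  generated i₀ P Pgen Pf Pd (l , δ , s) = transitive (λ δ → ∀ s → R (δ , s)) viaX viaY
    (states (zero , zero) (replicate r zero) Pgen) δ s l
    where
    R : State → Set
    R b = ∀ l → P (l , b)
    R-act : ∀ l b → R b → R (act l b)
    R-act l b Rb l′ = Pd (l′ , b) (l , act l b) (Rb l′) (Pf (l , b) (Rb l))
    states : ∀ δ s → R (δ , s) → ∀ s′ → R (δ , s′)
    states δ = vec-transitive (λ s → R (δ , s)) set
      where
      set : ∀ i a s → R (δ , s) → R (δ , s [ i ]≔ a)
      set i a s p = rot-transitive (λ a → R (δ , s [ i ]≔ a))
        (λ b q → subst (λ z → R (δ , z)) (updateAt-updateAt i s) (R-act (suc i) _ q))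
        (lookup s i) (subst (λ z → R (δ , z)) (sym (updateAt-id-local i s refl)) p) a
    θ₀ : ∀ δ → θ (replicate r zero) δ ≡ x δ
    θ₀ δ with constant? 0 (replicate r zero) | constant? 1 (replicate r zero)
    ... | yes _ | _ = refl
    ... | no n  | _ = ⊥-elim (n λ i → cong toℕ (lookup-replicate i zero))
    θ₁ : ∀ δ → θ (replicate r (suc zero)) δ ≡ y δ
    θ₁ δ with constant? 0 (replicate r (suc zero)) | constant? 1 (replicate r (suc zero))
    ... | yes p | _     = ⊥-elim (1≢0 (trans (sym (cong toℕ (lookup-replicate i₀ (suc zero)))) (p i₀)))
      where
      1≢0 : ¬ (1 ≡ 0)
      1≢0 ()
    ... | no _  | yes _ = refl
    ... | no _  | no n  = ⊥-elim (n λ i → cong toℕ (lookup-replicate i (suc zero)))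
    viaX : ∀ δ → (∀ s → R (δ , s)) → ∀ s → R (x δ , s)
    viaX δ p = states (x δ) (replicate r zero)
      (subst (λ z → R (z , replicate r zero)) (θ₀ δ) (R-act zero _ (p _)))
    viaY : ∀ δ → (∀ s → R (δ , s)) → ∀ s → R (y δ , s)
    viaY δ p = states (y δ) (replicate r (suc zero))
      (subst (λ z → R (z , replicate r (suc zero))) (θ₁ δ) (R-act zero _ (p _)))

  counters : Vec (Fin (2 + k)) r → Counters {r}
  counters s i = toℕ (lookup s i)

  acts-state : ∀ W δ s i → toℕ (lookup (proj₂ (acts W (δ , s))) i) ≡ run W (counters s) i % (2 + k)
  acts-state []          δ s i = sym (m<n⇒m%n≡m (Fin.toℕ<n (lookup s i)))
  acts-state (zero ∷ W)  δ s i = acts-state W δ s i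
  acts-state (suc j ∷ W) δ s i with j Fin.≟ i
  ... | yes refl = begin
    toℕ (lookup (updateAt s′ j rot) j)   ≡⟨ cong toℕ (lookup∘updateAt j s′) ⟩
    toℕ (rot (lookup s′ j))              ≡⟨ toℕ-rot (lookup s′ j) ⟩
    suc (toℕ (lookup s′ j)) % (2 + k)    ≡⟨ cong (λ z → suc z % (2 + k)) (acts-state W δ s j) ⟩
    suc (run W (counters s) j % (2 + k)) % (2 + k) ≡⟨ suc-% (run W (counters s) j) (2 + k) ⟩
    suc (run W (counters s) j) % (2 + k) ∎
    where
    open ≡-Reasoning
    s′ = proj₂ (acts W (δ , s))
  ... | no j≢i = trans (cong toℕ (lookup∘updateAt′ i j (j≢i ∘ sym) (proj₂ (acts W (δ , s))))) (acts-state W δ s i)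

  run-∉ : ∀ W (σ : Counters {r}) j → suc j ∉ᴸ W → run W σ j ≡ σ j
  run-∉ []          σ j n = refl
  run-∉ (zero ∷ W)  σ j n = run-∉ W σ j (n ∘ there)
  run-∉ (suc i ∷ W) σ j n with i Fin.≟ j
  ... | yes refl = ⊥-elim (n (here refl))
  ... | no _     = run-∉ W σ j (n ∘ there)

  acts-c∉ : ∀ W δ s → zero ∉ᴸ W → proj₁ (acts W (δ , s)) ≡ δ
  acts-c∉ []          δ s n = refl
  acts-c∉ (zero ∷ W)  δ s n = ⊥-elim (n (here refl))
  acts-c∉ (suc i ∷ W) δ s n = acts-c∉ W δ s (n ∘ there)

  state-∉ : ∀ W δ s j → suc j ∉ᴸ W → toℕ (lookup (proj₂ (acts W (δ , s))) j) ≡ toℕ (lookup s j)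
  state-∉ W δ s j n = trans (acts-state W δ s j)
    (trans (cong (_% (2 + k)) (run-∉ W (counters s) j n)) (m<n⇒m%n≡m (Fin.toℕ<n (lookup s j))))

  -- The counter j stays at 0, so c never meets the state 1 ... 1 and each of its occurrences acts
  -- by x or trivially.
  acts-x : ∀ W δ s j → suc j ∉ᴸ W → toℕ (lookup s j) ≡ 0 →
           proj₁ (acts W (δ , s)) ≡ power x (hits (2 + k) 0 W (counters s)) δ
  acts-x []          δ s j n s0 = refl
  acts-x (suc i ∷ W) δ s j n s0 = acts-x W δ s j (n ∘ there) s0
  acts-x (zero ∷ W)  δ s j n s0
    with constant? 0 (proj₂ (acts W (δ , s))) | constant? 1 (proj₂ (acts W (δ , s))) | matches? (2 + k) 0 (run W (counters s))
  ... | yes _ | _     | yes _ = cong x (acts-x W δ s j (n ∘ there) s0)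
  ... | yes p | _     | no q  = ⊥-elim (q λ i → trans (sym (acts-state W δ s i)) (p i))
  ... | no p  | _     | yes q = ⊥-elim (p λ i → trans (acts-state W δ s i) (q i))
  ... | no _  | no _  | no _  = acts-x W δ s j (n ∘ there) s0
  ... | no _  | yes q | no _  with trans (sym (q j)) (trans (state-∉ W δ s j (n ∘ there)) s0)
  ...   | ()

  acts-y : ∀ W δ s j → suc j ∉ᴸ W → toℕ (lookup s j) ≡ 1 →
           proj₁ (acts W (δ , s)) ≡ power y (hits (2 + k) 1 W (counters s)) δ
  acts-y []          δ s j n s1 = refl
  acts-y (suc i ∷ W) δ s j n s1 = acts-y W δ s j (n ∘ there) s1
  acts-y (zero ∷ W)  δ s j n s1
    with constant? 0 (proj₂ (acts W (δ , s))) | constant? 1 (proj₂ (acts W (δ , s))) | matches? (2 + k) 1 (run W (counters s))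
  ... | no _  | yes _ | yes _ = cong y (acts-y W δ s j (n ∘ there) s1)
  ... | no _  | yes p | no q  = ⊥-elim (q λ i → trans (sym (acts-state W δ s i)) (p i))
  ... | no _  | no p  | yes q = ⊥-elim (p λ i → trans (acts-state W δ s i) (q i))
  ... | no _  | no _  | no _  = acts-y W δ s j (n ∘ there) s1
  ... | yes q | _     | _     with trans (sym (q j)) (trans (state-∉ W δ s j (n ∘ there)) s1)
  ...   | ()

  acts-id : ∀ W δ s j u → suc j ∉ᴸ W → toℕ (lookup s j) ≡ 2 + u → proj₁ (acts W (δ , s)) ≡ δ
  acts-id []          δ s j u n s2 = refl
  acts-id (suc i ∷ W) δ s j u n s2 = acts-id W δ s j u (n ∘ there) s2
  acts-id (zero ∷ W)  δ s j u n s2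
    with constant? 0 (proj₂ (acts W (δ , s))) | constant? 1 (proj₂ (acts W (δ , s)))
  ... | no _  | no _  = acts-id W δ s j u (n ∘ there) s2
  ... | yes q | _     with trans (sym (q j)) (trans (state-∉ W δ s j (n ∘ there)) s2)
  ...   | ()
  acts-id (zero ∷ W)  δ s j u n s2 | no _ | yes q with trans (sym (q j)) (trans (state-∉ W δ s j (n ∘ there)) s2)
  ...   | ()

  acts-determined : ∀ W W′ δ s l → l ∉ᴸ W → l ∉ᴸ W′ →
    (∀ i → run W (counters s) i % (2 + k) ≡ run W′ (counters s) i % (2 + k)) →
    (∀ u → u < 2 + k → hits (2 + k) u W (counters s) % (2 + h) ≡ hits (2 + k) u W′ (counters s) % (2 + h)) →
    acts W (δ , s) ≡ acts W′ (δ , s)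
  acts-determined W W′ δ s l n n′ hrun hhits = cong₂ _,_ (first l n n′) (vec-ext _ _ λ i →
    Fin.toℕ-injective (trans (acts-state W δ s i) (trans (hrun i) (sym (acts-state W′ δ s i)))))
    where
    vec-ext : ∀ {A : Set} {r} (s t : Vec A r) → (∀ i → lookup s i ≡ lookup t i) → s ≡ t
    vec-ext []      []      h = refl
    vec-ext (a ∷ s) (b ∷ t) h = cong₂ _∷_ (h zero) (vec-ext s t (h ∘ suc))
    first : ∀ l → l ∉ᴸ W → l ∉ᴸ W′ → proj₁ (acts W (δ , s)) ≡ proj₁ (acts W′ (δ , s))
    first zero    n n′ = trans (acts-c∉ W δ s n) (sym (acts-c∉ W′ δ s n′))
    first (suc j) n n′ with toℕ (lookup s j) in eq
    ... | 0 = trans (acts-x W δ s j n eq) (trans (power-x-% (hits (2 + k) 0 W (counters s)) (hits (2 + k) 0 W′ (counters s)) (hhits 0 (s≤s z≤n)) δ) (sym (acts-x W′ δ s j n′ eq)))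
    ... | 1 = trans (acts-y W δ s j n eq) (trans (power-y-% (hits (2 + k) 1 W (counters s)) (hits (2 + k) 1 W′ (counters s)) (hhits 1 (s≤s (s≤s z≤n))) δ) (sym (acts-y W′ δ s j n′ eq)))
    ... | suc (suc u) = trans (acts-id W δ s j u n eq) (sym (acts-id W′ δ s j u n′ eq))

  Vec↔Fin : ∀ c r → Vec (Fin c) r ↔ Fin (c ^ℕ r)
  Vec↔Fin c zero    = mk↔ₛ′ (λ _ → zero) (λ _ → []) (λ { zero → refl }) (λ { [] → refl })
  Vec↔Fin c (suc r) = ↔-trans
    (mk↔ₛ′ {A = Vec (Fin c) (suc r)} {B = Fin c × Vec (Fin c) r}
      (λ s → head s , tail s) (λ { (a , s) → a ∷ s }) (λ _ → refl) (λ { (a ∷ s) → refl }))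
    (↔-trans (↔-refl ×-↔ Vec↔Fin c r) (↔-sym (Fin.*↔× {c} {c ^ℕ r})))

  model↔Fin : Σ ℕ λ N → Algebra.Carrier model ↔ Fin N
  model↔Fin = _ , ↔-trans (↔-refl ×-↔ (↔-trans (↔-sym Fin.*↔× ×-↔ Vec↔Fin (2 + k) r) (↔-sym Fin.*↔×))) (↔-sym Fin.*↔×)

-- Classical reasoning about finite sets

¬¬em : ∀ {a} (P : Set a) → ¬ ¬ (P ⊎ ¬ P)
¬¬em P k = k (inj₂ (λ p → k (inj₁ p)))

¬¬-Fin : ∀ {a} n {P : Fin n → Set a} → (∀ i → ¬ ¬ P i) → ¬ ¬ (∀ i → P i)
¬¬-Fin zero    h k = k λ ()
¬¬-Fin (suc n) h k = h zero λ p → ¬¬-Fin n (λ i → h (suc i)) λ q →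
  k λ { zero → p ; (suc i) → q i }

-- Each failure of maximality yields a point of larger measure, and `b ∸ μ x` bounds how often this
-- can happen.
¬¬-max : ∀ {a} {X : Set a} (μ : X → ℕ) b → (∀ x → μ x ≤ b) → X →
         ¬ ¬ Σ X λ x → ∀ y → μ y ≤ μ x
¬¬-max {X = X} μ b bd x₀ k = go b x₀ (m∸n≤m b (μ x₀))
  where
  go : ∀ j x → b ∸ μ x ≤ j → ⊥
  go zero    x le = k (x , λ y → ≤-trans (bd y) (m∸n≡0⇒m≤n (n≤0⇒n≡0 le)))
  go (suc j) x le = k (x , λ y → ≮⇒≥ λ lt → go j y (≤-pred (≤-trans (∸-monoʳ-< lt (bd y)) le)))

infix 4 _∈_ _∉_ _⊆_

-- A record, so that the subset can be inferred from a membership proof.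
record _∈_ {m} (x : Fin m) (S : Vec Bool m) : Set where
  constructor mem
  field is-true : lookup S x ≡ true
open _∈_ public

_∉_ : ∀ {m} → Fin m → Vec Bool m → Set
x ∉ S = ¬ (x ∈ S)

_⊆_ : ∀ {m} → Vec Bool m → Vec Bool m → Set
S ⊆ T = ∀ x → x ∈ S → x ∈ T

_∈?_ : ∀ {m} (x : Fin m) (S : Vec Bool m) → Dec (x ∈ S)
x ∈? S with lookup S x ≟ᵇ true
... | yes p = yes (mem p)
... | no ¬p = no (¬p ∘ is-true)

¬⊆⇒∃ : ∀ {m} {S T : Vec Bool m} → ¬ (S ⊆ T) → ¬ ¬ ∃ λ x → x ∈ S × x ∉ T
¬⊆⇒∃ {S = S} {T} h k = h λ x xS → go x xS (x ∈? T)
  where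
  go : ∀ x → x ∈ S → Dec (x ∈ T) → x ∈ T
  go x xS (yes p) = p
  go x xS (no n)  = ⊥-elim (k (x , xS , n))

-- Under a double negation P may be taken as decided at each of finitely many points. This is how
-- subgroups given by undecided conditions, such as the hypercentre, become subsets.
comprehension : ∀ {m a} (P : Fin m → Set a) →
                ¬ ¬ Σ (Vec Bool m) λ S → (∀ x → x ∈ S → P x) × (∀ x → P x → x ∈ S)
comprehension {m} P k = ¬¬-Fin m (λ i → ¬¬em (P i)) λ d →
  k (tabulate (bit d) , (λ x → to d x) , λ x → from d x)
  where
  module _ (d : ∀ i → P i ⊎ ¬ P i) where
    bit : Fin m → Bool
    bit i with d i
    ... | inj₁ _ = true
    ... | inj₂ _ = false
    to : ∀ x → x ∈ tabulate bit → P x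
    to x (mem e) rewrite lookup∘tabulate bit x with d x
    ... | inj₁ p = p
    to x (mem ()) | inj₂ _
    from : ∀ x → P x → x ∈ tabulate bit
    from x p = mem (trans (lookup∘tabulate bit x) bit-true)
      where
      bit-true : bit x ≡ true
      bit-true with d x
      ... | inj₁ _ = refl
      ... | inj₂ q = ⊥-elim (q p)

maxFin : ∀ m {P : Fin m → ℕ → Set} → (∀ y {i j} → i ≤ j → P y i → P y j) →
         (∀ y → ∃ (P y)) → ∃ λ c → ∀ y → P y c
maxFin zero    mono h = 0 , λ ()
maxFin (suc m) mono h with h zero | maxFin m (λ y → mono (suc y)) (λ y → h (suc y))
... | i , p | j , q = i + j , λ { zero → mono zero (m≤m+n i j) p
                                ; (suc y) → mono (suc y) (m≤n+m j i) (q y) }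

-- Group identities are decided by reduction in the free group.

data Expr (n : ℕ) : Set where
  v    : Fin n → Expr n
  ε    : Expr n
  _∙_  : Expr n → Expr n → Expr n
  _⁻   : Expr n → Expr n

infixl 7 _∙_
infix 8 _⁻

Signed : ℕ → Set
Signed n = Bool × Fin n

cons : ∀ {n} → Signed n → List (Signed n) → List (Signed n)
cons a [] = a ∷ []
cons (s , i) ((s′ , j) ∷ w) with s ≟ᵇ not s′ | i Fin.≟ j
... | yes _ | yes _ = w
... | _     | _     = (s , i) ∷ (s′ , j) ∷ w

reduce : ∀ {n} → Bool → Expr n → List (Signed n) → List (Signed n)
reduce s     (v i)   w = cons (s , i) w
reduce s     ε       w = w
reduce true  (x ∙ y) w = reduce true x (reduce true y w)
reduce false (x ∙ y) w = reduce false y (reduce false x w)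
reduce s     (x ⁻)   w = reduce (not s) x w

module GroupSolver {m : ℕ} (G : FinGroup m) where
  open FinGroup G

  cancelˡ : ∀ x y → inv x · (x · y) ≡ y
  cancelˡ x y = trans (sym (assoc _ _ _)) (trans (cong (_· y) (invˡ x)) (idˡ y))

  cancelˡ′ : ∀ x y → x · (inv x · y) ≡ y
  cancelˡ′ x y = trans (sym (assoc _ _ _)) (trans (cong (_· y) (invʳ x)) (idˡ y))

  inv-unique : ∀ x y → x · y ≡ e → y ≡ inv x
  inv-unique x y h = trans (sym (cancelˡ x y)) (trans (cong (inv x ·_) h) (idʳ _))

  inv-inv : ∀ x → inv (inv x) ≡ x
  inv-inv x = sym (inv-unique (inv x) x (invˡ x))

  inv-e : inv e ≡ e
  inv-e = sym (inv-unique e e (idˡ e))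

  inv-· : ∀ x y → inv (x · y) ≡ inv y · inv x
  inv-· x y = sym (inv-unique (x · y) (inv y · inv x)
    (trans (assoc _ _ _) (trans (cong (x ·_) (cancelˡ′ y (inv x))) (invʳ x))))

  module _ {n : ℕ} (ρ : Fin n → Fin m) where

    ⟦_⟧ : Expr n → Fin m
    ⟦ v i ⟧   = ρ i
    ⟦ ε ⟧     = e
    ⟦ x ∙ y ⟧ = ⟦ x ⟧ · ⟦ y ⟧
    ⟦ x ⁻ ⟧   = inv ⟦ x ⟧

    sgn : Bool → Fin m → Fin m
    sgn true  x = x
    sgn false x = inv x

    word : List (Signed n) → Fin m
    word []            = e
    word ((s , i) ∷ w) = sgn s (ρ i) · word w

    cons-sound : ∀ s i w → word (cons (s , i) w) ≡ sgn s (ρ i) · word w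
    cons-sound s i [] = refl
    cons-sound s i ((s′ , j) ∷ w) with s ≟ᵇ not s′ | i Fin.≟ j
    cons-sound _ i ((true  , j) ∷ w) | yes refl | yes refl = sym (cancelˡ (ρ i) (word w))
    cons-sound _ i ((false , j) ∷ w) | yes refl | yes refl = sym (cancelˡ′ (ρ i) (word w))
    ... | yes _ | no _ = refl
    ... | no _ | yes _ = refl
    ... | no _ | no _ = refl

    sgn-not : ∀ s x → sgn (not s) x ≡ sgn s (inv x)
    sgn-not true  x = refl
    sgn-not false x = sym (inv-inv x)

    reduce-sound : ∀ s x w → word (reduce s x w) ≡ sgn s ⟦ x ⟧ · word w
    reduce-sound s     (v i)   w = cons-sound s i w
    reduce-sound true  ε       w = sym (idˡ _)
    reduce-sound false ε       w = sym (trans (cong (_· word w) inv-e) (idˡ _))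
    reduce-sound true  (x ∙ y) w = trans (reduce-sound true x _)
      (trans (cong (⟦ x ⟧ ·_) (reduce-sound true y w)) (sym (assoc _ _ _)))
    reduce-sound false (x ∙ y) w = trans (reduce-sound false y _)
      (trans (cong (inv ⟦ y ⟧ ·_) (reduce-sound false x w))
        (trans (sym (assoc _ _ _)) (cong (_· word w) (sym (inv-· ⟦ x ⟧ ⟦ y ⟧)))))
    reduce-sound s     (x ⁻)   w = trans (reduce-sound (not s) x w) (cong (_· word w) (sgn-not s ⟦ x ⟧))

    solve : ∀ x y → reduce true x [] ≡ reduce true y [] → ⟦ x ⟧ ≡ ⟦ y ⟧
    solve x y h = trans (sym (idʳ _)) (trans (sym (reduce-sound true x []))
      (trans (cong word h) (trans (reduce-sound true y []) (idʳ _))))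

-- Sizes of subsets

ind : Bool → ℕ
ind true  = 1
ind false = 0

size : ∀ {m} → Vec Bool m → ℕ
size S = sum (λ x → ind (lookup S x))

sum-mono : ∀ {m} {f g : Fin m → ℕ} → (∀ x → f x ≤ g x) → sum f ≤ sum g
sum-mono {zero}  h = z≤n
sum-mono {suc m} h = +-mono-≤ (h zero) (sum-mono (h ∘ suc))

sum-mono-< : ∀ {m} {f g : Fin m → ℕ} → (∀ x → f x ≤ g x) → ∀ x → f x < g x → sum f < sum g
sum-mono-< h zero    lt = +-mono-<-≤ lt (sum-mono (h ∘ suc))
sum-mono-< h (suc x) lt = +-mono-≤-< (h zero) (sum-mono-< (h ∘ suc) x lt)

sum-*ʳ : ∀ {m} (f : Fin m → ℕ) c → sum (λ x → f x * c) ≡ sum f * c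
sum-*ʳ {zero}  f c = refl
sum-*ʳ {suc m} f c = trans (cong (f zero * c +_) (sum-*ʳ (f ∘ suc) c)) (sym (*-distribʳ-+ c (f zero) _))

ind-mono : ∀ {a b} → (a ≡ true → b ≡ true) → ind a ≤ ind b
ind-mono {true}  {true}  h = ≤-refl
ind-mono {true}  {false} h with h refl
... | ()
ind-mono {false}         h = z≤n

ind-true : ∀ {a} → a ≡ true → ind a ≡ 1
ind-true refl = refl

ind-false : ∀ {a} → ¬ (a ≡ true) → ind a ≡ 0
ind-false {true}  h = ⊥-elim (h refl)
ind-false {false} h = refl

size-strict : ∀ {m} {S T : Vec Bool m} → S ⊆ T → ∀ x → x ∈ T → x ∉ S → size S < size T
size-strict {S = S} {T} h x p q = sum-mono-< (λ x → ind-mono (λ p → is-true (h x (mem p)))) x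
  (subst₂ _<_ (sym (ind-false (λ r → q (mem r)))) (sym (ind-true (is-true p))) (s≤s z≤n))

size≤ : ∀ {m} (S : Vec Bool m) → size S ≤ m
size≤ []          = z≤n
size≤ (true  ∷ S) = s≤s (size≤ S)
size≤ (false ∷ S) = m≤n⇒m≤1+n (size≤ S)

⊆-size : ∀ {m} {S T : Vec Bool m} → S ⊆ T → size T ≤ size S → T ⊆ S
⊆-size {S = S} h le x xT with x ∈? S
... | yes p = p
... | no n  = ⊥-elim (<⇒≱ (size-strict h x xT n) le)

-- Subgroups, normalisers and upper central series

pow : ∀ {m} (G : FinGroup m) → Fin m → ℕ → Fin m
pow G t zero    = FinGroup.e G
pow G t (suc i) = FinGroup._·_ G t (pow G t i)

module Subgroups {m : ℕ} (G : FinGroup m) where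
  open FinGroup G public
  open GroupSolver G public using (solve; inv-e)

  infixl 21 _^_
  _^_ : Fin m → Fin m → Fin m
  x ^ y = (inv y · x) · y

  -- The reflected counterparts of _^_ and comm.
  conjE commE : ∀ {n} → Expr n → Expr n → Expr n
  conjE x y = (y ⁻ ∙ x) ∙ y
  commE x y = ((x ⁻ ∙ y ⁻) ∙ x) ∙ y

  record IsSub (S : Vec Bool m) : Set where
    field
      e∈   : e ∈ S
      ·∈   : ∀ {x y} → x ∈ S → y ∈ S → x · y ∈ S
      inv∈ : ∀ {x} → x ∈ S → inv x ∈ S

    ^∈ : ∀ {x y} → x ∈ S → y ∈ S → x ^ y ∈ S
    ^∈ p q = ·∈ (·∈ (inv∈ q) p) q

    comm∈ : ∀ {x y} → x ∈ S → y ∈ S → comm x y ∈ S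
    comm∈ p q = ·∈ (·∈ (·∈ (inv∈ p) (inv∈ q)) p) q
  open IsSub public

  -- With both implications, normalisers are closed under inverses by symmetry, without an appeal to
  -- finiteness.
  Normalises : Fin m → Vec Bool m → Set
  Normalises h S = ∀ x → (x ∈ S → x ^ h ∈ S) × (x ^ h ∈ S → x ∈ S)

  ^-· : ∀ x g h → x ^ (g · h) ≡ (x ^ g) ^ h
  ^-· x g h = solve (lookup (x ∷ g ∷ h ∷ [])) (conjE (v 0F) (v 1F ∙ v 2F)) (conjE (conjE (v 0F) (v 1F)) (v 2F)) refl

  ^-e : ∀ x → x ^ e ≡ x
  ^-e x = solve (lookup (x ∷ [])) (conjE (v 0F) ε) (v 0F) refl

  ^-inv : ∀ x h → (x ^ h) ^ inv h ≡ x
  ^-inv x h = solve (lookup (x ∷ h ∷ [])) (conjE (conjE (v 0F) (v 1F)) (v 1F ⁻)) (v 0F) refl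

  inv-^ : ∀ x h → (x ^ inv h) ^ h ≡ x
  inv-^ x h = solve (lookup (x ∷ h ∷ [])) (conjE (conjE (v 0F) (v 1F ⁻)) (v 1F)) (v 0F) refl

  e-^ : ∀ h → e ^ h ≡ e
  e-^ h = solve (lookup (h ∷ [])) (conjE ε (v 0F)) ε refl

  ·-^ : ∀ x y h → (x · y) ^ h ≡ x ^ h · y ^ h
  ·-^ x y h = solve (lookup (x ∷ y ∷ h ∷ [])) (conjE (v 0F ∙ v 1F) (v 2F)) (conjE (v 0F) (v 2F) ∙ conjE (v 1F) (v 2F)) refl

  inv-comm^ : ∀ x h → inv x ^ h ≡ inv (x ^ h)
  inv-comm^ x h = solve (lookup (x ∷ h ∷ [])) (conjE (v 0F ⁻) (v 1F)) (conjE (v 0F) (v 1F) ⁻) refl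

  comm-e : ∀ y → comm e y ≡ e
  comm-e y = solve (lookup (y ∷ [])) (commE ε (v 0F)) ε refl

  comm-·ˡ : ∀ x y z → comm (x · y) z ≡ comm x z ^ y · comm y z
  comm-·ˡ x y z = solve (lookup (x ∷ y ∷ z ∷ [])) (commE (v 0F ∙ v 1F) (v 2F))
    (conjE (commE (v 0F) (v 2F)) (v 1F) ∙ commE (v 1F) (v 2F)) refl

  comm-invˡ : ∀ x z → comm (inv x) z ≡ inv (comm x z) ^ inv x
  comm-invˡ x z = solve (lookup (x ∷ z ∷ [])) (commE (v 0F ⁻) (v 1F)) (conjE (commE (v 0F) (v 1F) ⁻) (v 0F ⁻)) refl

  comm-·ʳ : ∀ x y z → comm x (y · z) ≡ comm x z · comm x y ^ z
  comm-·ʳ x y z = solve (lookup (x ∷ y ∷ z ∷ [])) (commE (v 0F) (v 1F ∙ v 2F))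
    (commE (v 0F) (v 2F) ∙ conjE (commE (v 0F) (v 1F)) (v 2F)) refl

  comm-invʳ : ∀ x z → comm x (inv z) ≡ inv (comm x z) ^ inv z
  comm-invʳ x z = solve (lookup (x ∷ z ∷ [])) (commE (v 0F) (v 1F ⁻)) (conjE (commE (v 0F) (v 1F) ⁻) (v 1F ⁻)) refl

  comm-^ : ∀ x g y → comm (x ^ g) y ≡ comm x (y ^ inv g) ^ g
  comm-^ x g y = solve (lookup (x ∷ g ∷ y ∷ [])) (commE (conjE (v 0F) (v 1F)) (v 2F))
    (conjE (commE (v 0F) (conjE (v 2F) (v 1F ⁻))) (v 1F)) refl

  comm-flip : ∀ x y → comm x y ≡ inv (comm y x)
  comm-flip x y = solve (lookup (x ∷ y ∷ [])) (commE (v 0F) (v 1F)) (commE (v 1F) (v 0F) ⁻) refl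

  comm-def : ∀ x y → comm x y ≡ inv x · x ^ y
  comm-def x y = solve (lookup (x ∷ y ∷ [])) (commE (v 0F) (v 1F)) (v 0F ⁻ ∙ conjE (v 0F) (v 1F)) refl

  normalises-e : ∀ S → Normalises e S
  normalises-e S x = subst (_∈ S) (sym (^-e x)) , subst (_∈ S) (^-e x)

  normalises-· : ∀ {g h S} → Normalises g S → Normalises h S → Normalises (g · h) S
  normalises-· {g} {h} {S} p q x =
    (λ xS → subst (_∈ S) (sym (^-· x g h)) (proj₁ (q _) (proj₁ (p _) xS))) ,
    (λ xS → proj₂ (p _) (proj₂ (q _) (subst (_∈ S) (^-· x g h) xS)))

  normalises-inv : ∀ {h S} → Normalises h S → Normalises (inv h) S
  normalises-inv {h} {S} p x =
    (λ xS → proj₂ (p _) (subst (_∈ S) (sym (inv-^ x h)) xS)) ,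
    (λ xS → subst (_∈ S) (inv-^ x h) (proj₁ (p _) xS))

  normalises-self : ∀ {S} → IsSub S → ∀ {h} → h ∈ S → Normalises h S
  normalises-self {S} sub {h} hS x = (λ xS → ^∈ sub xS hS) ,
    λ xS → subst (_∈ S) (^-inv x h) (^∈ sub xS (inv∈ sub hS))

  normaliser : ∀ {H D} → IsSub H →
    ¬ ¬ Σ (Vec Bool m) λ K → IsSub K × K ⊆ H × (∀ h → h ∈ K → Normalises h D) ×
                                    (∀ h → h ∈ H → Normalises h D → h ∈ K)
  normaliser {H} {D} sH k = comprehension (λ h → h ∈ H × Normalises h D) λ { (K , to , from) →
    k (K , record { e∈ = from _ (e∈ sH , normalises-e D)
                  ; ·∈ = λ p q → from _ (·∈ sH (proj₁ (to _ p)) (proj₁ (to _ q)) ,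
                                         normalises-· (proj₂ (to _ p)) (proj₂ (to _ q)))
                  ; inv∈ = λ p → from _ (inv∈ sH (proj₁ (to _ p)) , normalises-inv (proj₂ (to _ p))) }
         , (λ x p → proj₁ (to x p)) , (λ x p → proj₂ (to x p)) , λ h p q → from h (p , q)) }

  -- The set h S h⁻¹ = { x ∣ x ^ h ∈ S }.
  cj : Fin m → Vec Bool m → Vec Bool m
  cj h S = tabulate (λ x → lookup S (x ^ h))

  cj-to : ∀ {h S x} → x ∈ cj h S → x ^ h ∈ S
  cj-to {h} {S} {x} (mem p) = mem (trans (sym (lookup∘tabulate (λ x → lookup S (x ^ h)) x)) p)

  cj-from : ∀ {h S x} → x ^ h ∈ S → x ∈ cj h S
  cj-from {h} {S} {x} (mem p) = mem (trans (lookup∘tabulate (λ x → lookup S (x ^ h)) x) p)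

  cj-sub : ∀ {h S} → IsSub S → IsSub (cj h S)
  cj-sub {h} {S} sub = record
    { e∈ = cj-from (subst (_∈ S) (sym (e-^ h)) (e∈ sub))
    ; ·∈ = λ p q → cj-from (subst (_∈ S) (sym (·-^ _ _ h)) (·∈ sub (cj-to p) (cj-to q)))
    ; inv∈ = λ p → cj-from (subst (_∈ S) (sym (inv-comm^ _ h)) (inv∈ sub (cj-to p))) }

  ∑-^ : ∀ (f : Fin m → ℕ) h → sum (λ x → f (x ^ h)) ≡ sum f
  ∑-^ f h = sym (sum-permute f (permutation (_^ h) (_^ inv h)
    (λ x → inv-^ x h) (λ x → ^-inv x h)))

  ∑-· : ∀ (f : Fin m → ℕ) g → sum (λ x → f (g · x)) ≡ sum f
  ∑-· f g = sym (sum-permute f (permutation (g ·_) (inv g ·_) c₂ c₁))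
    where
    open GroupSolver G using (cancelˡ; cancelˡ′)
    c₁ : ∀ x → inv g · (g · x) ≡ x
    c₁ = cancelˡ g
    c₂ : ∀ x → g · (inv g · x) ≡ x
    c₂ = cancelˡ′ g

  -- All commutators [x, y₁, ..., yᵢ] with yⱼ in H are trivial: the i-th term of the upper central
  -- series of H, with x ∈ H kept as a separate assumption.
  ζ : Vec Bool m → ℕ → Fin m → Set
  ζ H zero    x = x ≡ e
  ζ H (suc i) x = ∀ y → y ∈ H → ζ H i (comm x y)

  IsNilpotent : Vec Bool m → Set
  IsNilpotent H = ∃ λ c → ∀ x → x ∈ H → ζ H c x

  ζ-e : ∀ H i → ζ H i e
  ζ-e H zero    = refl
  ζ-e H (suc i) y _ = subst (ζ H i) (sym (comm-e y)) (ζ-e H i)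

  ζ-suc : ∀ H i x → ζ H i x → ζ H (suc i) x
  ζ-suc H zero    x refl y _ = comm-e y
  ζ-suc H (suc i) x z    y p = ζ-suc H i _ (z y p)

  ζ-mono : ∀ H {i j} x → i ≤ j → ζ H i x → ζ H j x
  ζ-mono H {i} x le z = go (≤⇒≤′ le)
    where
    go : ∀ {j} → i ≤′ j → ζ H j x
    go ≤′-refl     = z
    go (≤′-step p) = ζ-suc H _ x (go p)

  module _ {H} (sH : IsSub H) where

    ζ-^ : ∀ i {x g} → g ∈ H → ζ H i x → ζ H i (x ^ g)
    ζ-^ zero    {x} {g} gH refl = e-^ g
    ζ-^ (suc i) {x} {g} gH z y yH = subst (ζ H i) (sym (comm-^ x g y))
      (ζ-^ i gH (z _ (^∈ sH yH (inv∈ sH gH))))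

    ζ-· : ∀ i {x y} → y ∈ H → ζ H i x → ζ H i y → ζ H i (x · y)
    ζ-· zero    yH refl refl = idˡ e
    ζ-· (suc i) yH p q z zH = subst (ζ H i) (sym (comm-·ˡ _ _ z))
      (ζ-· i (comm∈ sH yH zH) (ζ-^ i yH (p z zH)) (q z zH))

    ζ-inv : ∀ i {x} → x ∈ H → ζ H i x → ζ H i (inv x)
    ζ-inv zero    xH refl = inv-e
    ζ-inv (suc i) {x} xH p z zH = subst (ζ H i) (sym (comm-invˡ x z))
      (ζ-^ i (inv∈ sH xH) (ζ-inv i (comm∈ sH xH zH) (p z zH)))

    -- The finitely many commutators of x have a common level c, which puts x at level `suc c`.
    -- Hence no element of H outside the hypercentre is central modulo it.
    ζ-limit : ∀ {x} → (∀ y → y ∈ H → ∃ λ c → ζ H c (comm x y)) → ∃ λ c → ζ H c x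
    ζ-limit {x} h with maxFin m {λ y c → y ∈ H → ζ H c (comm x y)}
                     (λ y le z yH → ζ-mono H _ le (z yH)) pick
      where
      pick : ∀ y → ∃ λ c → y ∈ H → ζ H c (comm x y)
      pick y with y ∈? H
      ... | yes yH = proj₁ (h y yH) , λ _ → proj₂ (h y yH)
      ... | no n   = 0 , λ yH → ⊥-elim (n yH)
    ... | c , z = suc c , z

    ζ-uniform : (∀ x → x ∈ H → ∃ λ c → ζ H c x) → IsNilpotent H
    ζ-uniform h = maxFin m {λ x c → x ∈ H → ζ H c x}
      (λ x le z xH → ζ-mono H _ le (z xH)) pick
      where
      pick : ∀ x → ∃ λ c → x ∈ H → ζ H c x
      pick x with x ∈? H
      ... | yes xH = proj₁ (h x xH) , λ _ → proj₂ (h x xH)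
      ... | no n   = 0 , λ xH → ⊥-elim (n xH)

    -- Climbs the upper central series of H: once the commutators of x with H lie in D, x normalises
    -- D and so belongs to it.
    normaliser-grows : IsNilpotent H → ∀ {D} → IsSub D → D ⊆ H →
      (∀ x → x ∈ H → Normalises x D → x ∈ D) → H ⊆ D
    normaliser-grows (c , nil) {D} sD D⊆H self x xH = go c x xH (nil x xH)
      where
      go : ∀ i x → x ∈ H → ζ H i x → x ∈ D
      go zero    x xH refl = e∈ sD
      go (suc i) x xH z = self x xH λ d →
        (λ dD → subst (_∈ D)
          (solve (lookup (x ∷ d ∷ [])) (v 1F ∙ commE (v 0F) (v 1F) ⁻) (conjE (v 1F) (v 0F)) refl)
          (·∈ sD dD (inv∈ sD (step d (D⊆H d dD))))) ,
        (λ dxD → subst (_∈ D)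
          (solve (lookup (x ∷ d ∷ [])) (conjE (v 1F) (v 0F) ∙ commE (v 0F) (v 1F)) (v 1F) refl)
          (·∈ sD dxD (step d (proj₂ (normalises-self sH xH d) (D⊆H _ dxD)))))
        where
        step : ∀ y → y ∈ H → comm x y ∈ D
        step y yH = go i (comm x y) (comm∈ sH xH yH) (z y yH)

-- Fixed-point-free sections and cyclic extensions

module Sections {m : ℕ} (G : FinGroup m) where
  open Subgroups G public

  -- Z / L is a nontrivial abelian section on which t acts without nontrivial fixed points.
  record FixedPointFree (Z L : Vec Bool m) (t : Fin m) : Set where
    field
      Z-sub      : IsSub Z
      L-sub      : IsSub L
      L⊆Z        : L ⊆ Z
      Z-inv      : ∀ {x} → x ∈ Z → x ^ t ∈ Z
      L-inv      : ∀ {x} → x ∈ L → x ^ t ∈ L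
      abelian    : ∀ {x y} → x ∈ Z → y ∈ Z → comm x y ∈ L
      fixed      : ∀ {x} → x ∈ Z → comm x t ∈ L → x ∈ L
      nontrivial : ∃ λ a → a ∈ Z × a ∉ L

    L^Z : ∀ {x z} → x ∈ L → z ∈ Z → x ^ z ∈ L
    L^Z {x} {z} xL zZ = subst (_∈ L)
      (solve (lookup (x ∷ z ∷ [])) (v 0F ∙ commE (v 0F) (v 1F)) (conjE (v 0F) (v 1F)) refl)
      (·∈ L-sub xL (abelian (L⊆Z _ xL) zZ))

  record _⊲_ (N H : Vec Bool m) : Set where
    field
      sub    : IsSub N
      ⊆H     : N ⊆ H
      normal : ∀ h → h ∈ H → Normalises h N

  -- H = ⟨N, t⟩. In this form a failure directly provides a proper subgroup containing N and t, and
  -- a proof is used by exhibiting an intermediate subgroup.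
  Generates : (H N : Vec Bool m) → Fin m → Set
  Generates H N t = ∀ K → IsSub K → N ⊆ K → t ∈ K → K ⊆ H → H ⊆ K

  centraliser : ∀ {H L} x → IsSub H → IsSub L → (∀ h → h ∈ H → Normalises h L) →
    ¬ ¬ Σ (Vec Bool m) λ K → IsSub K × K ⊆ H × (∀ h → h ∈ K → comm x h ∈ L) ×
                                    (∀ h → h ∈ H → comm x h ∈ L → h ∈ K)
  centraliser {H} {L} x sH sL nrm k = comprehension (λ h → h ∈ H × comm x h ∈ L) λ { (K , to , from) →
    k (K , record
      { e∈ = from _ (e∈ sH , subst (_∈ L) (sym (solve (lookup (x ∷ [])) (commE (v 0F) ε) ε refl)) (e∈ sL))
      ; ·∈ = λ {y} {z} p q → from _ (·∈ sH (proj₁ (to _ p)) (proj₁ (to _ q)) ,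
               subst (_∈ L) (sym (comm-·ʳ x y z))
                 (·∈ sL (proj₂ (to _ q)) (proj₁ (nrm z (proj₁ (to _ q)) _) (proj₂ (to _ p)))))
      ; inv∈ = λ {z} p → from _ (inv∈ sH (proj₁ (to _ p)) ,
               subst (_∈ L) (sym (comm-invʳ x z))
                 (proj₁ (normalises-inv (nrm z (proj₁ (to _ p))) _) (inv∈ sL (proj₂ (to _ p))))) }
      , (λ y p → proj₁ (to y p)) , (λ y p → proj₂ (to y p)) , λ h p q → from h (p , q)) }

  -- The centraliser of x modulo L is a subgroup that contains N and t.
  generated-commutes : ∀ {H N L t} x → IsSub H → IsSub L → (∀ h → h ∈ H → Normalises h L) →
    t ∈ H → N ⊆ H → Generates H N t → (∀ y → y ∈ N → comm x y ∈ L) → comm x t ∈ L →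
    ¬ ¬ (∀ y → y ∈ H → comm x y ∈ L)
  generated-commutes {H} {N} {L} {t} x sH sL nrm tH N⊆H gen cN ct k =
    centraliser x sH sL nrm λ { (K , sK , K⊆H , to , from) →
      k λ y yH → to y (gen K sK (λ z zN → from z (N⊆H z zN) (cN z zN)) (from t tH ct) K⊆H y yH) }

  module _ {H N t} (sH : IsSub H) (N⊲H : N ⊲ H) (tH : t ∈ H) (gen : Generates H N t) where
    open _⊲_ N⊲H renaming (sub to sN; ⊆H to N⊆H)

    -- H / N is generated by the image of t. As t commutes with N and with itself modulo N, it is
    -- central modulo N; then every x commutes modulo N with N and with t.
    derived⊆ : ¬ ¬ (∀ x y → x ∈ H → y ∈ H → comm x y ∈ N)
    derived⊆ k = generated-commutes t sH sN normal tH N⊆H gen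
      (λ y yN → subst (_∈ N) (solve (lookup (t ∷ y ∷ [])) (conjE (v 1F ⁻) (v 0F) ∙ v 1F) (commE (v 0F) (v 1F)) refl)
         (·∈ sN (proj₁ (normal t tH _) (inv∈ sN yN)) yN))
      (subst (_∈ N) (solve (lookup (t ∷ [])) ε (commE (v 0F) (v 0F)) refl) (e∈ sN)) λ ct →
      ¬¬-Fin m (λ x → each x ct) λ all → k λ x y xH yH → all x xH y yH
      where
      each : ∀ x → (∀ y → y ∈ H → comm t y ∈ N) → ¬ ¬ (x ∈ H → ∀ y → y ∈ H → comm x y ∈ N)
      each x ct k with x ∈? H
      ... | no n   = k λ xH → ⊥-elim (n xH)
      ... | yes xH = generated-commutes x sH sN normal tH N⊆H gen
        (λ y yN → subst (_∈ N) (solve (lookup (x ∷ y ∷ [])) (conjE (v 1F ⁻) (v 0F) ∙ v 1F) (commE (v 0F) (v 1F)) refl)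
           (·∈ sN (proj₁ (normal x xH _) (inv∈ sN yN)) yN))
        (subst (_∈ N) (sym (comm-flip x t)) (inv∈ sN (ct x xH)))
        λ r → k λ _ → r

    -- L is the part of N in the hypercentre of H, and Z / L the centre of N / L.
    module Hypercentre
      (L : Vec Bool m) (toL : ∀ x → x ∈ L → x ∈ N × ∃ λ c → ζ H c x)
      (fromL : ∀ x → x ∈ N × (∃ λ c → ζ H c x) → x ∈ L)
      (Z : Vec Bool m) (toZ : ∀ x → x ∈ Z → x ∈ N × (∀ y → y ∈ N → comm x y ∈ L))
      (fromZ : ∀ x → x ∈ N × (∀ y → y ∈ N → comm x y ∈ L) → x ∈ Z) where

      L-subgroup : IsSub L
      L-subgroup = record
        { e∈ = fromL _ (e∈ sN , 0 , refl)
        ; ·∈ = λ p q → fromL _ (·∈ sN (proj₁ (toL _ p)) (proj₁ (toL _ q)) ,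
            proj₁ (proj₂ (toL _ p)) + proj₁ (proj₂ (toL _ q)) ,
            ζ-· sH _ (N⊆H _ (proj₁ (toL _ q)))
              (ζ-mono H _ (m≤m+n _ _) (proj₂ (proj₂ (toL _ p))))
              (ζ-mono H _ (m≤n+m _ _) (proj₂ (proj₂ (toL _ q)))))
        ; inv∈ = λ p → fromL _ (inv∈ sN (proj₁ (toL _ p)) , _ ,
            ζ-inv sH _ (N⊆H _ (proj₁ (toL _ p))) (proj₂ (proj₂ (toL _ p)))) }

      L^ : ∀ {x h} → h ∈ H → x ∈ L → x ^ h ∈ L
      L^ hH p = fromL _ (proj₁ (normal _ hH _) (proj₁ (toL _ p)) , _ , ζ-^ sH _ hH (proj₂ (proj₂ (toL _ p))))

      L-normal : ∀ h → h ∈ H → Normalises h L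
      L-normal h hH x = L^ hH , λ p → subst (_∈ L) (^-inv x h) (L^ (inv∈ sH hH) p)

      L-closed : ∀ {x} → x ∈ N → (∀ y → y ∈ H → comm x y ∈ L) → x ∈ L
      L-closed xN h = fromL _ (xN , ζ-limit sH λ y yH → proj₂ (toL _ (h y yH)))

      Z-subgroup : IsSub Z
      Z-subgroup = record
        { e∈ = fromZ _ (e∈ sN , λ y _ → subst (_∈ L) (sym (comm-e y)) (e∈ L-subgroup))
        ; ·∈ = λ {x} {y} p q → fromZ _ (·∈ sN (proj₁ (toZ _ p)) (proj₁ (toZ _ q)) , λ z zN →
            subst (_∈ L) (sym (comm-·ˡ x y z))
              (·∈ L-subgroup (L^ (N⊆H _ (proj₁ (toZ _ q))) (proj₂ (toZ _ p) z zN)) (proj₂ (toZ _ q) z zN)))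
        ; inv∈ = λ {x} p → fromZ _ (inv∈ sN (proj₁ (toZ _ p)) , λ z zN →
            subst (_∈ L) (sym (comm-invˡ x z))
              (L^ (inv∈ sH (N⊆H _ (proj₁ (toZ _ p)))) (inv∈ L-subgroup (proj₂ (toZ _ p) z zN)))) }

      -- An element of Z fixed by t modulo L commutes modulo L with N, by the choice of Z, and with
      -- t, hence with H. It is then hypercentral and lies in L.
      fixedPointFree : ∀ {a} → a ∈ Z → a ∉ L → FixedPointFree Z L t
      fixedPointFree aZ a∉L = record
        { Z-sub = Z-subgroup
        ; L-sub = L-subgroup
        ; L⊆Z = λ x p → fromZ _ (proj₁ (toL _ p) , λ y yN → subst (_∈ L) (sym (comm-def x y))
            (·∈ L-subgroup (inv∈ L-subgroup p) (L^ (N⊆H _ yN) p)))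
        ; Z-inv = λ {x} p → fromZ _ (proj₁ (normal t tH _) (proj₁ (toZ _ p)) , λ y yN →
            subst (_∈ L) (sym (comm-^ x t y))
              (L^ tH (proj₂ (toZ _ p) _ (proj₁ (normalises-inv (normal t tH) _) yN))))
        ; L-inv = L^ tH
        ; abelian = λ p q → proj₂ (toZ _ p) _ (proj₁ (toZ _ q))
        ; fixed = λ {x} p q → decidable-stable (x ∈? L) λ x∉L →
            generated-commutes x sH L-subgroup L-normal tH N⊆H gen (proj₂ (toZ _ p)) q λ r →
              x∉L (L-closed (proj₁ (toZ _ p)) r)
        ; nontrivial = _ , aZ , a∉L }

    -- Without fixed-point-free sections Z equals L: the nilpotent group N / L has trivial centre,
    -- so N = L is hypercentral in H. As H / N is abelian, all commutators of H are hypercentral and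
    -- H is nilpotent.
    cyclic-extension : (∀ Z L t → ¬ FixedPointFree Z L t) → IsNilpotent N → ¬ ¬ IsNilpotent H
    cyclic-extension noFPF (c , nilN) k =
      comprehension (λ x → x ∈ N × ∃ λ c → ζ H c x) λ { (L , toL , fromL) →
      comprehension (λ x → x ∈ N × (∀ y → y ∈ N → comm x y ∈ L)) λ { (Z , toZ , fromZ) →
      absurd L toL fromL Z toZ fromZ } }
      where
      absurd : ∀ L toL fromL Z toZ fromZ → ⊥
      absurd L toL fromL Z toZ fromZ = derived⊆ λ der →
        k (ζ-uniform sH λ x xH → ζ-limit sH λ y yH →
          let q = der x y xH yH in proj₂ (toL _ (N⊆L c _ q (nilN _ q))))
        where
        open Hypercentre L toL fromL Z toZ fromZ
        Z⊆L : Z ⊆ L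
        Z⊆L x p = decidable-stable (x ∈? L) λ x∉L → noFPF Z L t (fixedPointFree p x∉L)
        N⊆L : ∀ i x → x ∈ N → ζ N i x → x ∈ L
        N⊆L zero    x xN refl = e∈ L-subgroup
        N⊆L (suc i) x xN z = Z⊆L x (fromZ x (xN , λ y yN → N⊆L i _ (comm∈ sN xN yN) (z y yN)))

-- Maximal subgroups containing N, counted with their conjugates

ind-cong : ∀ {a b} → (a ≡ true → b ≡ true) → (b ≡ true → a ≡ true) → ind a ≡ ind b
ind-cong f g = ≤-antisym (ind-mono f) (ind-mono g)

ind-∧ : ∀ a b → ind (a ∧ b) ≡ ind b * ind a
ind-∧ true  b = sym (*-identityʳ (ind b))
ind-∧ false b = sym (*-zeroʳ (ind b))

ind-split : ∀ a b c → (a ≡ true → b ≡ true → c ≡ true) → ind (a ∧ not b ∧ c) + ind (a ∧ b) ≡ ind (a ∧ c)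
ind-split false b     c h = refl
ind-split true  false c h = +-identityʳ (ind c)
ind-split true  true  c h = sym (ind-true (h refl refl))

∧-split : ∀ {a b c} → a ∧ not b ∧ c ≡ true → a ≡ true × ¬ (b ≡ true) × c ≡ true
∧-split {true} {false} {true} _ = refl , (λ ()) , refl
∧-split {true} {true} ()

∧-join : ∀ {a b c} → a ≡ true → ¬ (b ≡ true) → c ≡ true → a ∧ not b ∧ c ≡ true
∧-join {b = false} refl _ refl = refl
∧-join {b = true}  _ n _ = ⊥-elim (n refl)

sum-∧ : ∀ {m} (a : Bool) (g : Fin m → Bool) → sum (λ x → ind (a ∧ g x)) ≡ ind a * sum (λ x → ind (g x))
sum-∧ a g = trans (sum-cong-≗ (λ x → ind-∧ a (g x))) (trans (sum-*ʳ (λ x → ind (g x)) (ind a)) (*-comm _ (ind a)))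

sum-zero : ∀ {m} (f : Fin m → ℕ) → (∀ x → f x ≡ 0) → sum f ≡ 0
sum-zero {zero}  f h = refl
sum-zero {suc m} f h = cong₂ _+_ (h zero) (sum-zero (f ∘ suc) (h ∘ suc))

size-pos : ∀ {m} {S : Vec Bool m} {x} → x ∈ S → 0 < size S
size-pos {S = S} {x} p = ≤-<-trans z≤n
  (sum-mono-< {f = λ _ → 0} (λ _ → z≤n) x (subst (0 <_) (sym (ind-true (is-true p))) (s≤s z≤n)))

-- In a section H / N (N maximal normal in H) all of whose proper subgroups are
-- nilpotent, distinct maximal subgroups meet trivially; counting the elements in
-- the conjugates of two of them shows that H / N must be cyclic.
module MaximalSubgroups {m : ℕ} (G : FinGroup m) {H N : Vec Bool m}
  (sH : Subgroups.IsSub G H) (N⊲H : Sections._⊲_ G N H) where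
  open Sections G
  open _⊲_ N⊲H renaming (sub to sN; ⊆H to N⊆H)

  Proper : Vec Bool m → Set
  Proper K = ∃ λ x → x ∈ H × x ∉ K

  record Max (M : Vec Bool m) : Set where
    field
      M-sub   : IsSub M
      N⊆M     : N ⊆ M
      M⊆H     : M ⊆ H
      proper  : Proper M
      maximal : ∀ K → IsSub K → M ⊆ K → K ⊆ H → Proper K → K ⊆ M
  open Max

  exMax : ∀ {K} → IsSub K → N ⊆ K → K ⊆ H → Proper K → ¬ ¬ Σ (Vec Bool m) λ M → Max M × K ⊆ M
  exMax {K} sK N⊆K K⊆H pK k =
    ¬¬-max {X = Σ (Vec Bool m) λ M → IsSub M × K ⊆ M × M ⊆ H × Proper M}
      (λ X → size (proj₁ X)) m (λ X → size≤ (proj₁ X)) (K , sK , (λ _ p → p) , K⊆H , pK)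
      λ { ((M , sM , K⊆M , M⊆H , pM) , mx) →
        k (M , record { M-sub = sM ; N⊆M = λ x p → K⊆M x (N⊆K x p) ; M⊆H = M⊆H ; proper = pM
          ; maximal = λ K′ sK′ M⊆K′ K′⊆H pK′ →
              ⊆-size M⊆K′ (mx (K′ , sK′ , (λ x p → M⊆K′ x (K⊆M x p)) , K′⊆H , pK′)) } , K⊆M) }

  Max-cj : ∀ {M h} → h ∈ H → Max M → Max (cj h M)
  Max-cj {M} {h} hH mM = record
    { M-sub = cj-sub (M-sub mM)
    ; N⊆M = λ x p → cj-from (N⊆M mM _ (proj₁ (normal h hH x) p))
    ; M⊆H = λ x p → proj₂ (normalises-self sH hH x) (M⊆H mM _ (cj-to p))
    ; proper = let (x , xH , x∉M) = proper mM in
        x ^ inv h , ^∈ sH xH (inv∈ sH hH) , λ p → x∉M (subst (_∈ M) (inv-^ x h) (cj-to p))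
    ; maximal = λ K sK M⊆K K⊆H (x , xH , x∉K) y yK → cj-from
        (maximal mM (cj (inv h) K) (cj-sub sK)
          (λ z zM → cj-from (M⊆K _ (cj-from (subst (_∈ M) (sym (inv-^ z h)) zM))))
          (λ z p → proj₂ (normalises-self sH (inv∈ sH hH) z) (K⊆H _ (cj-to p)))
          (x ^ h , ^∈ sH xH hH , λ p → x∉K (subst (_∈ K) (^-inv x h) (cj-to p)))
          (y ^ h) (cj-from (subst (_∈ K) (sym (^-inv y h)) yK))) }

  -- The assumption that `cyclic` refutes is `¬gen`, that H / N is not cyclic.
  module _ (N-max : ∀ D → D ⊲ H → Proper D → size D ≤ size N)
           (N-proper : Proper N)
           (¬gen : ∀ t → t ∈ H → ¬ Generates H N t)
           (nilp : ∀ K → IsSub K → K ⊆ H → Proper K → ¬ ¬ IsNilpotent K) where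

    exMax-∋ : ∀ {x} → x ∈ H → ¬ ¬ Σ (Vec Bool m) λ M → Max M × x ∈ M
    exMax-∋ {x} xH k = ¬gen x xH λ K sK N⊆K xK K⊆H y yH → decidable-stable (y ∈? K) λ y∉K →
      exMax sK N⊆K K⊆H (y , yH , y∉K) λ { (M , mM , K⊆M) → k (M , mM , K⊆M x xK) }

    -- A normal M has at most as many elements as N, so M = N. But any x of H outside M lies
    -- together with N in a proper subgroup, which the maximality of M puts inside M.
    not-normal : ∀ {M} → Max M → ¬ (∀ h → h ∈ H → Normalises h M)
    not-normal {M} mM nrm = let (x , xH , x∉M) = proper mM in
      ¬gen x xH λ K sK N⊆K xK K⊆H y yH → decidable-stable (y ∈? K) λ y∉K →
        x∉M (maximal mM K sK (λ z zM → N⊆K z (M⊆N z zM)) K⊆H (y , yH , y∉K) x xK)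
      where
      M⊆N : M ⊆ N
      M⊆N = ⊆-size (N⊆M mM)
        (N-max M (record { sub = M-sub mM ; ⊆H = M⊆H mM ; normal = nrm }) (proper mM))

    self-normalising : ∀ {M} → Max M → ∀ {h} → h ∈ H → Normalises h M → h ∈ M
    self-normalising {M} mM {h} hH nh = decidable-stable (h ∈? M) λ h∉M →
      normaliser {H} {M} sH λ { (K , sK , K⊆H , to , from) →
      ¬¬em (Proper K) λ
        { (inj₁ pK) → h∉M (maximal mM K sK
             (λ x xM → from x (M⊆H mM x xM) (normalises-self (M-sub mM) xM)) K⊆H pK h (from h hH nh))
        ; (inj₂ np) → not-normal mM λ g gH → to g (decidable-stable (g ∈? K) λ g∉K → np (g , gH , g∉K)) } }

    ⊈N : ∀ {M} → Max M → ¬ (M ⊆ N)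
    ⊈N {M} mM M⊆N = not-normal mM λ h hH x →
      (λ p → N⊆M mM _ (proj₁ (normal h hH x) (M⊆N _ p))) ,
      (λ p → N⊆M mM _ (proj₂ (normal h hH x) (M⊆N _ p)))

    meet : ∀ {S T} → IsSub S → IsSub T → ¬ ¬ Σ (Vec Bool m) λ D → IsSub D ×
      (∀ x → x ∈ D → x ∈ S × x ∈ T) × (∀ x → x ∈ S → x ∈ T → x ∈ D)
    meet {S} {T} sS sT k = comprehension (λ x → x ∈ S × x ∈ T) λ { (D , to , from) →
      k (D , record { e∈ = from _ (e∈ sS , e∈ sT)
                    ; ·∈ = λ p q → from _ (·∈ sS (proj₁ (to _ p)) (proj₁ (to _ q)) , ·∈ sT (proj₂ (to _ p)) (proj₂ (to _ q)))
                    ; inv∈ = λ p → from _ (inv∈ sS (proj₁ (to _ p)) , inv∈ sT (proj₂ (to _ p))) }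
           , to , λ x p q → from x (p , q)) }

    record Pair : Set where
      field
        {M₁ M₂ D} : Vec Bool m
        max₁     : Max M₁
        max₂     : Max M₂
        distinct : ¬ (M₁ ⊆ M₂)
        D-sub    : IsSub D
        D-to     : ∀ x → x ∈ D → x ∈ M₁ × x ∈ M₂
        D-from   : ∀ x → x ∈ M₁ → x ∈ M₂ → x ∈ D

    -- Choose distinct maximal subgroups M₁, M₂ whose intersection D is largest; here D is larger
    -- than N. So D is not normal in H, and its normaliser lies in a maximal M₃. Normalisers grow in
    -- the nilpotent group M₁, so M₁ ∩ M₃ exceeds D and M₁ ⊆ M₃ by the choice of the pair. Likewise
    -- M₂ ⊆ M₃, whence M₁ ⊆ M₃ ⊆ M₂, a contradiction.
    intersection : ∀ {M M′} → Max M → Max M′ → ∀ {x} → x ∈ M → x ∈ M′ → x ∉ N → M ⊆ M′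
    intersection {M} {M′} mM mM′ {x} xM xM′ x∉N y yM = decidable-stable (y ∈? M′) λ y∉M′ →
      meet (M-sub mM) (M-sub mM′) λ { (D₀ , sD₀ , to₀ , from₀) →
      ¬¬-max {X = Pair} (λ P → size (Pair.D P)) m (λ P → size≤ (Pair.D P))
        (record { max₁ = mM ; max₂ = mM′ ; distinct = λ h → y∉M′ (h y yM)
                ; D-sub = sD₀ ; D-to = to₀ ; D-from = from₀ })
        λ { (P , mx) → go P mx (<-≤-trans
            (size-strict {S = N} (λ z p → from₀ z (N⊆M mM z p) (N⊆M mM′ z p)) x (from₀ x xM xM′) x∉N)
            (mx (record { max₁ = mM ; max₂ = mM′ ; distinct = λ h → y∉M′ (h y yM)
                ; D-sub = sD₀ ; D-to = to₀ ; D-from = from₀ }))) } }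
      where
      go : (P : Pair) → (∀ P′ → size (Pair.D P′) ≤ size (Pair.D P)) → size N < size (Pair.D P) → ⊥
      go P mx N<D = normaliser {H} {D} sH λ { (K , sK , K⊆H , to , from) →
        ¬¬em (Proper K) λ
          { (inj₂ np) → <⇒≱ N<D (N-max D
              (record { sub = D-sub ; ⊆H = λ z p → M⊆H max₁ z (proj₁ (D-to z p))
                      ; normal = λ g gH → to g (decidable-stable (g ∈? K) λ g∉K → np (g , gH , g∉K)) })
              (let (z , zH , z∉M) = proper max₁ in z , zH , λ p → z∉M (proj₁ (D-to z p))))
          ; (inj₁ pK) → exMax sK
              (λ z zN → from z (N⊆H z zN) (normalises-self D-sub (D-from z (N⊆M max₁ z zN) (N⊆M max₂ z zN))))
              K⊆H pK λ { (M₃ , m₃ , K⊆M₃) →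
              let D⊆M₃ : D ⊆ M₃
                  D⊆M₃ z p = K⊆M₃ z (from z (M⊆H max₁ z (proj₁ (D-to z p))) (normalises-self D-sub p))
                  K′ : ∀ g → g ∈ H → Normalises g D → g ∈ M₃
                  K′ g gH ng = K⊆M₃ g (from g gH ng)
              in absorb max₁ m₃ D⊆M₃ K′ (λ z p → proj₁ (D-to z p)) M₁⊈D λ M₁⊆M₃ →
                 absorb max₂ m₃ D⊆M₃ K′ (λ z p → proj₂ (D-to z p)) M₂⊈D λ M₂⊆M₃ →
                 distinct λ z p → maximal max₂ M₃ (M-sub m₃) M₂⊆M₃ (M⊆H m₃) (proper m₃) z (M₁⊆M₃ z p) } } }
        where
        open Pair P
        M₁⊈D : ¬ (M₁ ⊆ D)
        M₁⊈D h = distinct λ z p → proj₂ (D-to z (h z p))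
        M₂⊈D : ¬ (M₂ ⊆ D)
        M₂⊈D h = distinct (maximal max₂ M₁ (M-sub max₁) (λ z p → proj₁ (D-to z (h z p))) (M⊆H max₁) (proper max₁))
        absorb : ∀ {M M₃} → Max M → Max M₃ → D ⊆ M₃ → (∀ g → g ∈ H → Normalises g D → g ∈ M₃) →
                 D ⊆ M → ¬ (M ⊆ D) → ¬ ¬ (M ⊆ M₃)
        absorb {M} {M₃} mM m₃ D⊆M₃ K′ D⊆M M⊈D k = nilp M (M-sub mM) (M⊆H mM) (proper mM) λ nil →
          M⊈D (normaliser-grows (M-sub mM) nil D-sub D⊆M λ g gM ng → decidable-stable (g ∈? D) λ g∉D →
            meet (M-sub mM) (M-sub m₃) λ { (D′ , sD′ , to′ , from′) →
            <⇒≱ (size-strict {S = D} {T = D′} (λ z p → from′ z (D⊆M z p) (D⊆M₃ z p)) g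
                   (from′ g gM (K′ g (M⊆H mM g gM) ng)) g∉D)
                (mx (record { max₁ = mM ; max₂ = m₃ ; distinct = k ; D-sub = sD′ ; D-to = to′ ; D-from = from′ })) })

    -- C consists of the elements outside N in the conjugates of M. The pairs (h, x) with h ∈ H, x ∉
    -- N and x ^ h ∈ M are counted by rows and by columns, giving |C| |M| = |H| (|M| - |N|), which
    -- `count` states without subtraction.
    module Count {M} (mM : Max M) (C : Vec Bool m)
      (C-to : ∀ x → x ∈ C → x ∉ N × ∃ λ h → h ∈ H × x ^ h ∈ M)
      (C-from : ∀ x → x ∉ N → ∀ h → h ∈ H → x ^ h ∈ M → x ∈ C) where

      w : Fin m → Fin m → ℕ
      w h x = ind (lookup H h ∧ not (lookup N x) ∧ lookup M (x ^ h))

      row : ∀ h → sum (w h) + ind (lookup H h) * size N ≡ ind (lookup H h) * size M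
      row h = begin
        sum (w h) + ind (lookup H h) * size N
          ≡⟨ cong (sum (w h) +_) (sum-∧ (lookup H h) (lookup N)) ⟨
        sum (w h) + sum (λ x → ind (lookup H h ∧ lookup N x))
          ≡⟨ ∑-distrib-+ (w h) (λ x → ind (lookup H h ∧ lookup N x)) ⟨
        sum (λ x → w h x + ind (lookup H h ∧ lookup N x))
          ≡⟨ sum-cong-≗ (λ x → ind-split (lookup H h) (lookup N x) (lookup M (x ^ h))
               (λ hH xN → is-true (N⊆M mM _ (proj₁ (normal h (mem hH) x) (mem xN))))) ⟩
        sum (λ x → ind (lookup H h ∧ lookup M (x ^ h)))
          ≡⟨ sum-∧ (lookup H h) (λ x → lookup M (x ^ h)) ⟩
        ind (lookup H h) * sum (λ x → ind (lookup M (x ^ h)))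
          ≡⟨ cong (ind (lookup H h) *_) (∑-^ (λ x → ind (lookup M x)) h) ⟩
        ind (lookup H h) * size M ∎
        where open ≡-Reasoning

      -- The conjugates of M by h₀ and h share x outside N, hence coincide, so h₀⁻¹ h normalises M
      -- and lies in M. The elements that conjugate x into M thus form one coset of M, which gives
      -- the column sum.
      coset : ∀ {x h h₀} → x ∉ N → h ∈ H → h₀ ∈ H → x ^ h ∈ M → x ^ h₀ ∈ M → inv h₀ · h ∈ M
      coset {x} {h} {h₀} x∉N hH h₀H p p₀ = self-normalising mM (·∈ sH (inv∈ sH h₀H) hH) λ y →
        (λ yM → subst (_∈ M) (^-coset y h₀ h)
           (cj-to (intersection (Max-cj h₀H mM) (Max-cj hH mM) (cj-from p₀) (cj-from p) x∉N
             (y ^ inv h₀) (cj-from (subst (_∈ M) (sym (inv-^ y h₀)) yM))))) ,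
        (λ yM → subst (_∈ M) (inv-^ y h₀)
           (cj-to (intersection (Max-cj hH mM) (Max-cj h₀H mM) (cj-from p) (cj-from p₀) x∉N
             (y ^ inv h₀) (cj-from (subst (_∈ M) (sym (^-coset y h₀ h)) yM)))))
        where
        ^-coset : ∀ y h₀ h → (y ^ inv h₀) ^ h ≡ y ^ (inv h₀ · h)
        ^-coset y h₀ h = sym (^-· y (inv h₀) h)

      column : ∀ x → sum (λ h → w h x) ≡ ind (lookup C x) * size M
      column x with x ∈? C
      ... | no x∉C = trans
              (sum-zero _ λ h → ind-false λ p →
                 let (hH , x∉N , xhM) = ∧-split p in x∉C (C-from x (x∉N ∘ is-true) h (mem hH) (mem xhM)))
              (sym (cong (_* size M) (ind-false (x∉C ∘ mem))))
      ... | yes xC with C-to x xC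
      ...   | x∉N , h₀ , h₀H , p₀ = begin
        sum (λ h → w h x)
          ≡⟨ sum-cong-≗ (λ h → ind-cong
               (λ p → let (hH , _ , xhM) = ∧-split p in is-true (coset x∉N (mem hH) h₀H (mem xhM) p₀))
               (λ p → ∧-join
                 (is-true (subst (_∈ H) (unshift h) (·∈ sH h₀H (M⊆H mM _ (mem p)))))
                 (x∉N ∘ mem)
                 (is-true (subst (_∈ M) (conj h) (^∈ (M-sub mM) p₀ (mem p)))))) ⟩
        sum (λ h → ind (lookup M (inv h₀ · h)))
          ≡⟨ ∑-· (λ h → ind (lookup M h)) (inv h₀) ⟩
        size M
          ≡⟨ *-identityˡ (size M) ⟨
        1 * size M
          ≡⟨ cong (_* size M) (ind-true (is-true xC)) ⟨
        ind (lookup C x) * size M ∎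
        where
        open ≡-Reasoning
        unshift : ∀ h → h₀ · (inv h₀ · h) ≡ h
        unshift h = GroupSolver.cancelˡ′ G h₀ h
        conj : ∀ h → (x ^ h₀) ^ (inv h₀ · h) ≡ x ^ h
        conj h = trans (sym (^-· x h₀ (inv h₀ · h))) (cong (x ^_) (unshift h))

      count : size C * size M + size H * size N ≡ size H * size M
      count = begin
        size C * size M + size H * size N
          ≡⟨ cong₂ _+_ (sum-*ʳ (λ x → ind (lookup C x)) (size M)) (sum-*ʳ (λ x → ind (lookup H x)) (size N)) ⟨
        sum (λ x → ind (lookup C x) * size M) + sum (λ h → ind (lookup H h) * size N)
          ≡⟨ cong (_+ _) (sum-cong-≗ column) ⟨
        sum (λ x → sum (λ h → w h x)) + sum (λ h → ind (lookup H h) * size N)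
          ≡⟨ cong (_+ _) (∑-comm w) ⟨
        sum (λ h → sum (w h)) + sum (λ h → ind (lookup H h) * size N)
          ≡⟨ ∑-distrib-+ (λ h → sum (w h)) (λ h → ind (lookup H h) * size N) ⟨
        sum (λ h → sum (w h) + ind (lookup H h) * size N)
          ≡⟨ sum-cong-≗ row ⟩
        sum (λ h → ind (lookup H h) * size M)
          ≡⟨ sum-*ʳ (λ h → ind (lookup H h)) (size M) ⟩
        size H * size M ∎
        where open ≡-Reasoning

      index≥2 : size N + size N ≤ size M
      index≥2 = decidable-stable (size N + size N ≤? size M) λ neg → ¬⊆⇒∃ (⊈N mM) λ { (y , yM , y∉N) →
        neg (begin
          size N + size N ≡⟨ cong (size N +_) (∑-· (λ x → ind (lookup N x)) (inv y)) ⟨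
          size N + sum (λ x → ind (lookup N (inv y · x))) ≡⟨ ∑-distrib-+ (λ x → ind (lookup N x)) _ ⟨
          sum (λ x → ind (lookup N x) + ind (lookup N (inv y · x))) ≤⟨ sum-mono (λ x → disjoint yM y∉N x) ⟩
          size M ∎) }
        where
        open ≤-Reasoning
        disjoint : ∀ {y} → y ∈ M → y ∉ N → ∀ x → ind (lookup N x) + ind (lookup N (inv y · x)) ≤ ind (lookup M x)
        disjoint {y} yM y∉N x with x ∈? N | (inv y · x) ∈? N
        ... | yes p | yes q = ⊥-elim (y∉N (subst (_∈ N)
                (solve (lookup (x ∷ y ∷ [])) (v 0F ∙ (v 1F ⁻ ∙ v 0F) ⁻) (v 1F) refl) (·∈ sN p (inv∈ sN q))))
        ... | yes p | no q = ≤-trans (≤-reflexive (trans (cong (_ +_) (ind-false (q ∘ mem))) (+-identityʳ _)))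
                (ind-mono (λ r → is-true (N⊆M mM x (mem r))))
        ... | no p | yes q = ≤-trans (≤-reflexive (cong (_+ ind (lookup N (inv y · x))) (ind-false (p ∘ mem))))
                (ind-mono (λ r → is-true (subst (_∈ M) (GroupSolver.cancelˡ′ G y x) (·∈ (M-sub mM) yM (N⊆M mM _ (mem r))))))
        ... | no p | no q = ≤-trans (≤-reflexive (cong₂ _+_ (ind-false (p ∘ mem)) (ind-false (q ∘ mem)))) z≤n

      -- By `count`, |C| = |H| (1 - |N| / |M|), and |N| / |M| is at most one half.
      half : size H ≤ size C + size C
      half = *-cancelʳ-≤ (size H) (size C + size C) (size M) {{>-nonZero (size-pos (e∈ (M-sub mM)))}} (+-cancelʳ-≤ (size H * size M) _ _ (begin
        size H * size M + size H * size M
          ≡⟨ cong₂ _+_ count count ⟨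
        (size C * size M + size H * size N) + (size C * size M + size H * size N)
          ≡⟨ +-*-Solver.solve 4 (λ c m h n → (c :* m :+ h :* n) :+ (c :* m :+ h :* n) := (c :+ c) :* m :+ h :* (n :+ n))
               refl (size C) (size M) (size H) (size N) ⟩
        (size C + size C) * size M + size H * (size N + size N)
          ≤⟨ +-monoʳ-≤ ((size C + size C) * size M) (*-monoʳ-≤ (size H) index≥2) ⟩
        (size C + size C) * size M + size H * size M ∎))
        where
        open ≤-Reasoning
        open +-*-Solver using (_:*_; _:+_; _:=_)

      -- Otherwise |H| ≤ |C| + |N|, which `count` turns into |H| ≤ |M|.
      uncovered : ¬ ¬ ∃ λ x → x ∈ H × x ∉ N × x ∉ C
      uncovered k = <⇒≱ M<H (*-cancelʳ-≤ (size H) (size M) (size N) {{>-nonZero (size-pos (e∈ sN))}}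
        (+-cancelˡ-≤ (size C * size M) _ _ (begin
          size C * size M + size H * size N ≡⟨ count ⟩
          size H * size M                   ≤⟨ *-monoˡ-≤ (size M) H≤C+N ⟩
          (size C + size N) * size M        ≡⟨ *-distribʳ-+ (size M) (size C) (size N) ⟩
          size C * size M + size N * size M ≡⟨ cong (size C * size M +_) (*-comm (size N) (size M)) ⟩
          size C * size M + size M * size N ∎)))
        where
        open ≤-Reasoning
        M<H : size M < size H
        M<H = let (x , xH , x∉M) = proper mM in size-strict (M⊆H mM) x xH x∉M
        H≤C+N : size H ≤ size C + size N
        H≤C+N = ≤-trans (sum-mono λ x → cover x) (≤-reflexive (∑-distrib-+ (λ x → ind (lookup C x)) (λ x → ind (lookup N x))))
          where
          cover : ∀ x → ind (lookup H x) ≤ ind (lookup C x) + ind (lookup N x)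
          cover x with x ∈? N | x ∈? C
          ... | yes p | _     = ≤-trans (ind-mono (λ _ → is-true p)) (m≤n+m _ (ind (lookup C x)))
          ... | no _  | yes q = ≤-trans (ind-mono (λ _ → is-true q)) (m≤m+n _ (ind (lookup N x)))
          ... | no p  | no q  = ≤-trans (≤-reflexive (ind-false λ r → k (x , mem r , p , q))) z≤n

    -- Take a second maximal subgroup M′ through an element x that N and the conjugates of M miss. C
    -- and C′ are disjoint and each has at least half as many elements as H, which leaves no room
    -- for N.
    cyclic : ⊥
    cyclic = exMax-∋ (proj₁ (proj₂ N-proper)) λ { (M , mM , _) →
      comprehension (Covered M) λ { (C , to , from) →
      Count.uncovered mM C to (λ x x∉N h hH p → from x (x∉N , h , hH , p)) λ { (x , xH , x∉N , x∉C) →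
      exMax-∋ xH λ { (M′ , mM′ , xM′) →
      comprehension (Covered M′) λ { (C′ , to′ , from′) →
        let disj : ∀ y → y ∈ C → y ∉ C′
            -- A common element would put a conjugate of M′ inside a conjugate of M, and x with it
            -- into some conjugate of M.
            disj y p q =
              let (y∉N , h , hH , yM) = to y p
                  (_ , h′ , h′H , yM′) = to′ y q
              in x∉C (from x (x∉N , inv h′ · h , ·∈ sH (inv∈ sH h′H) hH ,
                   subst (_∈ M) (sym (^-· x (inv h′) h))
                     (cj-to (intersection (Max-cj h′H mM′) (Max-cj hH mM) (cj-from yM′) (cj-from yM) y∉N
                       (x ^ inv h′) (cj-from (subst (_∈ M′) (sym (inv-^ x h′)) xM′))))))
        in contra C C′ (Covered⊆H mM ∘₂ to) (Covered⊆H mM′ ∘₂ to′)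
             disj (λ y p → proj₁ (to y p)) (λ y p → proj₁ (to′ y p))
             (Count.half mM C to (λ x x∉N h hH p → from x (x∉N , h , hH , p)))
             (Count.half mM′ C′ to′ (λ x x∉N h hH p → from′ x (x∉N , h , hH , p))) } } } } }
      where
      Covered : Vec Bool m → Fin m → Set
      Covered M x = x ∉ N × ∃ λ h → h ∈ H × x ^ h ∈ M
      Covered⊆H : ∀ {M} → Max M → ∀ {x} → Covered M x → x ∈ H
      Covered⊆H mM {x} (_ , h , hH , p) = proj₂ (normalises-self sH hH x) (M⊆H mM _ p)
      contra : ∀ C C′ → C ⊆ H → C′ ⊆ H → (∀ y → y ∈ C → y ∉ C′) → (∀ y → y ∈ C → y ∉ N) → (∀ y → y ∈ C′ → y ∉ N) →
        size H ≤ size C + size C → size H ≤ size C′ + size C′ → ⊥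
      contra C C′ C⊆H C′⊆H disj C∩N C′∩N h h′ = <⇒≱ N>0 (+-cancelˡ-≤ (size H + size H) _ _ (begin
        (size H + size H) + (size N + size N)
          ≤⟨ +-monoˡ-≤ (size N + size N) (+-mono-≤ h h′) ⟩
        ((size C + size C) + (size C′ + size C′)) + (size N + size N)
          ≡⟨ +-*-Solver.solve 3 (λ c c′ n → ((c :+ c) :+ (c′ :+ c′)) :+ (n :+ n) := (c :+ c′ :+ n) :+ (c :+ c′ :+ n))
               refl (size C) (size C′) (size N) ⟩
        (size C + size C′ + size N) + (size C + size C′ + size N)
          ≤⟨ +-mono-≤ total total ⟩
        size H + size H
          ≡⟨ +-identityʳ _ ⟨
        (size H + size H) + 0 ∎))
        where
        open ≤-Reasoning
        open +-*-Solver using (_:+_; _:=_)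
        N>0 : 0 < size N + size N
        N>0 = <-≤-trans (size-pos (e∈ sN)) (m≤m+n _ _)
        pointwise : ∀ y → ind (lookup C y) + ind (lookup C′ y) + ind (lookup N y) ≤ ind (lookup H y)
        pointwise y with y ∈? C | y ∈? C′ | y ∈? N
        ... | yes p | yes q | _     = ⊥-elim (disj y p q)
        ... | yes p | no q  | yes r = ⊥-elim (C∩N y p r)
        ... | no p  | yes q | yes r = ⊥-elim (C′∩N y q r)
        ... | yes p | no q  | no r
          rewrite ind-true (is-true p) | ind-false (q ∘ mem) | ind-false (r ∘ mem) | ind-true (is-true (C⊆H y p)) = ≤-refl
        ... | no p  | yes q | no r
          rewrite ind-false (p ∘ mem) | ind-true (is-true q) | ind-false (r ∘ mem) | ind-true (is-true (C′⊆H y q)) = ≤-refl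
        ... | no p  | no q  | yes r
          rewrite ind-false (p ∘ mem) | ind-false (q ∘ mem) | ind-true (is-true r) | ind-true (is-true (N⊆H y r)) = ≤-refl
        ... | no p  | no q  | no r
          rewrite ind-false (p ∘ mem) | ind-false (q ∘ mem) | ind-false (r ∘ mem) = z≤n
        total : size C + size C′ + size N ≤ size H
        total = ≤-trans (≤-reflexive (sym (trans
          (∑-distrib-+ (λ y → ind (lookup C y) + ind (lookup C′ y)) (λ y → ind (lookup N y)))
          (cong (_+ size N) (∑-distrib-+ (λ y → ind (lookup C y)) (λ y → ind (lookup C′ y)))))))
          (sum-mono pointwise)

-- Finding the section Z / L and the element t

module NonNilpotent {m : ℕ} (G : FinGroup m) where
  open Sections G

  -- Induction on a bound for the size makes the proper subgroups nilpotent. If H is not trivial,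
  -- the search for a largest proper normal subgroup N can start from the trivial one; `cyclic` then
  -- reduces to H = ⟨N, t⟩, where `cyclic-extension` applies.
  subgroups-nilpotent : (∀ Z L t → ¬ FixedPointFree Z L t) →
    ∀ b H → size H < b → IsSub H → ¬ ¬ IsNilpotent H
  subgroups-nilpotent noFPF (suc b) H H<b sH k =
    ¬¬em (∃ λ x → x ∈ H × ¬ (x ≡ e)) λ
      { (inj₂ triv) → k (0 , λ x xH → decidable-stable (x Fin.≟ e) λ x≢e → triv (x , xH , x≢e))
      ; (inj₁ (x₀ , x₀H , x₀≢e)) → comprehension (_≡ e) λ { (E , toE , fromE) →
        ¬¬-max {X = Σ (Vec Bool m) λ N → N ⊲ H × ∃ λ x → x ∈ H × x ∉ N}
          (λ X → size (proj₁ X)) m (λ X → size≤ (proj₁ X))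
          (E , trivial E toE fromE , x₀ , x₀H , λ p → x₀≢e (toE _ p))
          λ { ((N , N⊲H , pN) , mx) →
          MaximalSubgroups.cyclic G sH N⊲H (λ D D⊲H pD → mx (D , D⊲H , pD)) pN
            (λ t tH gen → nilp N (_⊲_.sub N⊲H) (_⊲_.⊆H N⊲H) pN λ nilN →
              cyclic-extension sH N⊲H tH gen noFPF nilN k)
            nilp } } }
    where
    nilp : ∀ K → IsSub K → K ⊆ H → (∃ λ x → x ∈ H × x ∉ K) → ¬ ¬ IsNilpotent K
    nilp K sK K⊆H (x , xH , x∉K) =
      subgroups-nilpotent noFPF b K (<-≤-trans (size-strict K⊆H x xH x∉K) (≤-pred H<b)) sK
    trivial : ∀ E → (∀ x → x ∈ E → x ≡ e) → (∀ x → x ≡ e → x ∈ E) → E ⊲ H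
    trivial E to from = record
      { sub = record
          { e∈ = from _ refl
          ; ·∈ = λ p q → from _ (trans (cong₂ _·_ (to _ p) (to _ q)) (idˡ e))
          ; inv∈ = λ p → from _ (trans (cong inv (to _ p)) inv-e) }
      ; ⊆H = λ x p → subst (_∈ H) (sym (to x p)) (e∈ sH)
      ; normal = λ h _ x → (λ p → from _ (trans (cong (_^ h) (to x p)) (e-^ h))) ,
          λ p → from _ (trans (sym (^-inv x h)) (trans (cong (_^ inv h) (to _ p)) (e-^ (inv h)))) }

  ¬nilpotent⇒fixedPointFree : ¬ Nilpotent →
    ¬ ¬ Σ (Vec Bool m) λ Z → Σ (Vec Bool m) λ L → Σ (Fin m) λ t → FixedPointFree Z L t
  ¬nilpotent⇒fixedPointFree ¬nil k =
    subgroups-nilpotent (λ Z L t s → k (Z , L , t , s)) (suc (size full)) full ≤-refl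
      (record { e∈ = all _ ; ·∈ = λ _ _ → all _ ; inv∈ = λ _ → all _ })
      λ { (c , nil) → ¬nil (c , λ x → ζ⇒Zeta c x (nil x (all x))) }
    where
    full : Vec Bool m
    full = replicate m true
    all : ∀ x → x ∈ full
    all x = mem (lookup-replicate x true)
    ζ⇒Zeta : ∀ c x → ζ full c x → Zeta c x
    ζ⇒Zeta zero    x z = z
    ζ⇒Zeta (suc c) x z y = ζ⇒Zeta c (comm x y) (z y (all y))

  infixr 22 _^^_
  _^^_ : Fin m → ℕ → Fin m
  t ^^ i = pow G t i

  pow-comm : ∀ t i → t ^^ i · t ≡ t · t ^^ i
  pow-comm t zero    = trans (idˡ t) (sym (idʳ t))
  pow-comm t (suc i) = trans (assoc _ _ _) (cong (t ·_) (pow-comm t i))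

  -- Weaker than irreducibility of Z / L under t, of which it is the consequence needed.
  record Irreducible (Z L : Vec Bool m) (t : Fin m) : Set where
    field
      fpf   : FixedPointFree Z L t
      -- Exponents up to m suffice because t has order at most m, and the bound makes the property
      -- decidable.
      dichotomy : ∀ (i : Fin (suc m)) → (∀ x → x ∈ Z → comm x (t ^^ toℕ i) ∈ L) ⊎
                                     (∀ x → x ∈ Z → comm x (t ^^ toℕ i) ∈ L → x ∈ L)

  module _ {Z L t} (S : FixedPointFree Z L t) (K : Vec Bool m) (i : ℕ)
    (K-to : ∀ x → x ∈ K → x ∈ Z × comm x (t ^^ i) ∈ L) (K-from : ∀ x → x ∈ Z × comm x (t ^^ i) ∈ L → x ∈ K) where
    open FixedPointFree S

    private
      s : Fin m
      s = t ^^ i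

    ^pow : ∀ {T} → (∀ {x} → x ∈ T → x ^ t ∈ T) → ∀ j {x} → x ∈ T → x ^ (t ^^ j) ∈ T
    ^pow {T} h zero    p = subst (_∈ T) (sym (^-e _)) p
    ^pow {T} h (suc j) p = subst (_∈ T) (sym (^-· _ _ _)) (^pow h j (h p))

    L⊆fix : L ⊆ K
    L⊆fix x xL = K-from x (L⊆Z x xL , subst (_∈ L) (sym (comm-def x s)) (·∈ L-sub (inv∈ L-sub xL) (^pow L-inv i xL)))

    -- Conjugation by s commutes with conjugation by t, and Z / L is abelian.
    swap : ∀ {x} → x ∈ Z → comm (comm x t) s ∈ L → comm (comm x s) t ∈ L
    swap {x} xZ h = subst (_∈ L) eq₂ (·∈ L-sub (subst (_∈ L) eq₁ h) (L^Z l∈ yZ))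
      where
      a b y : Fin m
      a = inv (x ^ t)
      b = inv (x ^ s)
      y = x ^ (t · s)
      aZ : a ∈ Z
      aZ = inv∈ Z-sub (Z-inv xZ)
      bZ : b ∈ Z
      bZ = inv∈ Z-sub (^pow Z-inv i xZ)
      yZ : y ∈ Z
      yZ = ^pow Z-inv (suc i) xZ
      l∈ : comm b (a · x) · comm x a ∈ L
      l∈ = ·∈ L-sub (abelian bZ (·∈ Z-sub aZ xZ)) (abelian xZ aZ)
      env : Fin 3 → Fin m
      env = lookup (x ∷ t ∷ s ∷ [])
      aE bE yE : Expr 3
      aE = conjE (v 0F) (v 1F) ⁻
      bE = conjE (v 0F) (v 2F) ⁻
      yE = conjE (v 0F) (v 1F ∙ v 2F)
      eq₁ : comm (comm x t) s ≡ ((a · x) · b) · y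
      eq₁ = solve env (commE (commE (v 0F) (v 1F)) (v 2F)) (((aE ∙ v 0F) ∙ bE) ∙ yE) refl
      eq₂ : (((a · x) · b) · y) · (comm b (a · x) · comm x a) ^ y ≡ comm (comm x s) t
      eq₂ = trans
        (solve env ((((aE ∙ v 0F) ∙ bE) ∙ yE) ∙ conjE (commE bE (aE ∙ v 0F) ∙ commE (v 0F) aE) yE)
          (((bE ∙ v 0F) ∙ aE) ∙ yE) refl)
        (trans (cong (λ u → ((b · x) · a) · (x ^ u)) (sym (pow-comm t i)))
          (solve env (((bE ∙ v 0F) ∙ aE) ∙ conjE (v 0F) (v 2F ∙ v 1F)) (commE (commE (v 0F) (v 2F)) (v 1F)) refl))

    -- If [x, t] is fixed by s modulo L, then by `swap` [x, s] is fixed by t modulo L. So [x, s]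
    -- lies in L and x in K, which means that t stays fixed-point-free modulo K.
    fixed-points : (∃ λ x → x ∈ Z × x ∉ K) → FixedPointFree Z K t
    fixed-points nt = record
      { Z-sub = Z-sub
      ; L-sub = record
          { e∈ = L⊆fix e (e∈ L-sub)
          ; ·∈ = λ {x} {y} p q → K-from _ (·∈ Z-sub (proj₁ (K-to _ p)) (proj₁ (K-to _ q)) ,
              subst (_∈ L) (sym (comm-·ˡ x y s)) (·∈ L-sub (L^Z (proj₂ (K-to _ p)) (proj₁ (K-to _ q))) (proj₂ (K-to _ q))))
          ; inv∈ = λ {x} p → K-from _ (inv∈ Z-sub (proj₁ (K-to _ p)) ,
              subst (_∈ L) (sym (comm-invˡ x s)) (L^Z (inv∈ L-sub (proj₂ (K-to _ p))) (inv∈ Z-sub (proj₁ (K-to _ p))))) }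
      ; L⊆Z = λ x p → proj₁ (K-to x p)
      ; Z-inv = Z-inv
      ; L-inv = λ {x} p → K-from _ (Z-inv (proj₁ (K-to _ p)) , subst (_∈ L) (comm-shift x) (L-inv (proj₂ (K-to _ p))))
      ; abelian = λ p q → L⊆fix _ (abelian p q)
      ; fixed = λ {x} xZ p → K-from x (xZ ,
          fixed (subst (_∈ Z) (sym (comm-def x s)) (·∈ Z-sub (inv∈ Z-sub xZ) (^pow Z-inv i xZ)))
            (swap xZ (proj₂ (K-to _ p))))
      ; nontrivial = nt }
      where
      comm-shift : ∀ x → comm x s ^ t ≡ comm (x ^ t) s
      comm-shift x = trans
        (solve (lookup (x ∷ s ∷ t ∷ [])) (conjE (commE (v 0F) (v 1F)) (v 2F))
          (commE (conjE (v 0F) (v 2F)) (v 2F ⁻ ∙ (v 1F ∙ v 2F))) refl)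
        (cong (comm (x ^ t)) (trans (cong (inv t ·_) (pow-comm t i)) (GroupSolver.cancelˡ G t s)))

  -- Choose L as large as possible. The fixed points of a power of t on Z / L could replace L unless
  -- they are everything, so otherwise they lie in L.
  irreducible : ∀ {Z L t} → FixedPointFree Z L t → ¬ ¬ Σ (Vec Bool m) λ L → Irreducible Z L t
  irreducible {Z} {L₀} {t} S₀ k =
    ¬¬-max {X = Σ (Vec Bool m) λ L → FixedPointFree Z L t} (λ X → size (proj₁ X)) m (λ X → size≤ (proj₁ X)) (L₀ , S₀)
      λ { ((L , S) , mx) → ¬¬-Fin (suc m) {λ i → (∀ x → x ∈ Z → comm x (t ^^ toℕ i) ∈ L) ⊎
                                     (∀ x → x ∈ Z → comm x (t ^^ toℕ i) ∈ L → x ∈ L)}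
        (λ i k′ → comprehension (λ x → x ∈ Z × comm x (t ^^ toℕ i) ∈ L) λ { (K , to , from) →
          ¬¬em (∃ λ x → x ∈ Z × x ∉ K) λ
            { (inj₁ nt) → k′ (inj₂ λ x xZ p → ⊆-size (L⊆fix S K (toℕ i) to from)
                (mx (K , fixed-points S K (toℕ i) to from nt)) x (from x (xZ , p)))
            ; (inj₂ ¬nt) → k′ (inj₁ λ x xZ → proj₂ (to x (decidable-stable (x ∈? K) λ n → ¬nt (x , xZ , n)))) } })
        λ pw → k (L , record { fpf = S ; dichotomy = pw }) }

  ∀∈? : ∀ {P : Fin m → Set} (S : Vec Bool m) → (∀ x → Dec (P x)) → Dec (∀ x → x ∈ S → P x)
  ∀∈? S P? = Fin.all? λ x → (x ∈? S) →-dec P? x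

  isSub? : ∀ S → Dec (IsSub S)
  isSub? S = map′ (λ { (a , b , c) → record { e∈ = a ; ·∈ = λ p q → b _ p _ q ; inv∈ = λ p → c _ p } })
    (λ s → e∈ s , (λ _ p _ q → ·∈ s p q) , (λ _ p → inv∈ s p))
    ((e ∈? S) ×-dec ∀∈? S (λ x → ∀∈? S (λ y → (x · y) ∈? S)) ×-dec ∀∈? S (λ x → inv x ∈? S))

  fixedPointFree? : ∀ Z L t → Dec (FixedPointFree Z L t)
  fixedPointFree? Z L t = map′
    (λ { (a , b , c , d , f , g , h , i) → record { Z-sub = a ; L-sub = b ; L⊆Z = c ; Z-inv = d _ ; L-inv = f _
        ; abelian = λ p q → g _ p _ q ; fixed = h _ ; nontrivial = i } })
    (λ S → let open FixedPointFree S in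
      Z-sub , L-sub , L⊆Z , (λ _ → Z-inv) , (λ _ → L-inv) , (λ _ p _ q → abelian p q) , (λ _ → fixed) , nontrivial)
    (isSub? Z ×-dec isSub? L ×-dec ∀∈? L (λ x → x ∈? Z) ×-dec ∀∈? Z (λ x → (x ^ t) ∈? Z) ×-dec ∀∈? L (λ x → (x ^ t) ∈? L)
      ×-dec ∀∈? Z (λ x → ∀∈? Z (λ y → comm x y ∈? L))
      ×-dec ∀∈? Z (λ x → (comm x t ∈? L) →-dec (x ∈? L))
      ×-dec Fin.any? (λ a → (a ∈? Z) ×-dec ¬? (a ∈? L)))

  irreducible? : ∀ Z L t → Dec (Irreducible Z L t)
  irreducible? Z L t = map′ (λ { (a , b) → record { fpf = a ; dichotomy = b } })
    (λ S → Irreducible.fpf S , Irreducible.dichotomy S)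
    (fixedPointFree? Z L t ×-dec Fin.all? (λ i →
      ∀∈? Z (λ x → comm x (t ^^ toℕ i) ∈? L) ⊎-dec ∀∈? Z (λ x → (comm x (t ^^ toℕ i) ∈? L) →-dec (x ∈? L))))

  ¬nilpotent⇒irreducible : ¬ Nilpotent →
    Σ (Vec Bool m) λ Z → Σ (Vec Bool m) λ L → Σ (Fin m) λ t → Irreducible Z L t
  ¬nilpotent⇒irreducible ¬nil = decidable-stable
    (anySubset? λ Z → anySubset? λ L → Fin.any? λ t → irreducible? Z L t)
    λ k → ¬nilpotent⇒fixedPointFree ¬nil λ { (Z , L₀ , t , S) →
      irreducible S λ { (L , I) → k (Z , L , t , I) } }

-- Counting modulo the order of t and of a

least : ∀ {P : ℕ → Set} → (∀ n → Dec (P n)) → ∀ n → P n → ∃ λ k → k ≤ n × P k × (∀ i → i < k → ¬ P i)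
least P? n p with P? 0
... | yes p₀ = 0 , z≤n , p₀ , λ _ ()
least P? zero    p | no ¬p₀ = ⊥-elim (¬p₀ p)
least P? (suc n) p | no ¬p₀ with least (P? ∘ suc) n p
... | k , k≤n , pk , below = suc k , s≤s k≤n , pk , λ { zero _ → ¬p₀ ; (suc i) (s≤s lt) → below i lt }

module Multiples (A : AbelianGroup 0ℓ 0ℓ) where
  open AbelianGroup A renaming (_∙_ to _⊕_; ε to 0#; _⁻¹ to ⊖_; ∙-cong to ⊕-cong) hiding (refl; sym; trans)
  open AbelianGroup A using () renaming (refl to ≈-refl; sym to ≈-sym; trans to ≈-trans)
  open import Algebra.Properties.AbelianGroup A using (identityʳ-unique)
  open import Algebra.Properties.CommutativeMonoid.Mult commutativeMonoid renaming (_×_ to _·_)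

  module _ (a : Carrier) (h₁ : ℕ) (h·a≈0 : suc h₁ · a ≈ 0#)
    (minimal : ∀ i → i < h₁ → ¬ (suc i · a ≈ 0#)) where

    private
      h : ℕ
      h = suc h₁

    *h·a≈0 : ∀ q → (q * h) · a ≈ 0#
    *h·a≈0 zero    = ≈-refl
    *h·a≈0 (suc q) = ≈-trans (×-homo-+ a h (q * h)) (≈-trans (⊕-cong h·a≈0 (*h·a≈0 q)) (identityˡ 0#))

    %·a : ∀ p → p · a ≈ (p % h) · a
    %·a p = ≈-trans (reflexive (cong (_· a) (m≡m%n+[m/n]*n p h)))
      (≈-trans (×-homo-+ a (p % h) (p / h * h)) (≈-trans (⊕-cong ≈-refl (*h·a≈0 (p / h))) (identityʳ _)))

    distinct : ∀ {i j} → i < j → j < h → ¬ (i · a ≈ j · a)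
    distinct {i} {j} i<j j<h eq with j ∸ i in d
    ... | zero  = <⇒≱ i<j (m∸n≡0⇒m≤n d)
    ... | suc n = minimal n (≤-pred (subst (_< h) d (≤-<-trans (m∸n≤m j i) j<h)))
      (identityʳ-unique (i · a) (suc n · a) (≈-trans (≈-sym (×-homo-+ a i (suc n)))
        (≈-trans (reflexive (cong (_· a) (trans (cong (i +_) (sym d)) (m+[n∸m]≡n (<⇒≤ i<j))))) (≈-sym eq))))

    order : ∀ {p q} → p · a ≈ q · a → p % h ≡ q % h
    order {p} {q} eq with <-cmp (p % h) (q % h)
    ... | tri< lt _ _ = ⊥-elim (distinct lt (m%n<n q h) (≈-trans (≈-sym (%·a p)) (≈-trans eq (%·a q))))
    ... | tri≈ _ e _  = e
    ... | tri> _ _ gt = ⊥-elim (distinct gt (m%n<n p h) (≈-trans (≈-sym (%·a q)) (≈-trans (≈-sym eq) (%·a p))))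

prod : ∀ {m n} (G : FinGroup m) → (Fin n → Fin m) → List (Fin n) → Fin m
prod G g = foldr (λ i → FinGroup._·_ G (g i)) (FinGroup.e G)

-- A semigroup identity of G determines the counters modulo 2 + k, and the number of
-- occurrences of c at any given state modulo 2 + h.
Isolates : ∀ {m} → FinGroup m → ℕ → ℕ → Set
Isolates {m} G k h = ∀ r (W W′ : List (Fin (suc r))) → (∀ g → prod G g W ≡ prod G g W′) → ∀ σ →
  (∀ i → run W σ i % (2 + k) ≡ run W′ σ i % (2 + k)) ×
  (∀ u → u < 2 + k → hits (2 + k) u W σ % (2 + h) ≡ hits (2 + k) u W′ σ % (2 + h))

-- Semigroup identities of G evaluated on Z / L

module Section {m : ℕ} (G : FinGroup m) {Z L : Vec Bool m} {t : Fin m}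
  (I : NonNilpotent.Irreducible G Z L t) where
  open Sections G
  open NonNilpotent G
  open Irreducible I
  open FixedPointFree fpf

  pow-+ : ∀ g i j → g ^^ (i + j) ≡ g ^^ i · g ^^ j
  pow-+ g zero    j = sym (idˡ _)
  pow-+ g (suc i) j = trans (cong (g ·_) (pow-+ g i j)) (sym (assoc _ _ _))

  cancel : ∀ {x y z} → x · y ≡ x · z → y ≡ z
  cancel {x} {y} {z} h = trans (sym (GroupSolver.cancelˡ G x y)) (trans (cong (inv x ·_) h) (GroupSolver.cancelˡ G x z))

  finite-order : ∀ g → ∃ λ j → j < m × g ^^ suc j ≡ e
  finite-order g with Fin.pigeonhole (n<1+n m) (λ i → g ^^ toℕ i)
  ... | i , j , i<j , eq with toℕ j ∸ toℕ i in d
  ...   | zero  = ⊥-elim (<⇒≱ i<j (m∸n≡0⇒m≤n d))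
  ...   | suc n = n , subst (_≤ m) d (≤-trans (m∸n≤m (toℕ j) (toℕ i)) (≤-pred (Fin.toℕ<n j))) ,
    cancel (trans (sym (pow-+ g (toℕ i) (suc n)))
      (trans (cong (g ^^_) (trans (cong (toℕ i +_) (sym d)) (m+[n∸m]≡n (<⇒≤ i<j)))) (trans (sym eq) (sym (idʳ _)))))

  Carrier : Set
  Carrier = Σ (Fin m) (_∈ Z)

  infix 4 _≈_
  -- A record, so that the two sides can be inferred from a proof.
  record _≈_ (x y : Carrier) : Set where
    constructor mod-L
    field quotient : inv (proj₁ x) · proj₁ y ∈ L
  open _≈_

  ≡⇒≈ : ∀ {x y} → proj₁ x ≡ proj₁ y → x ≈ y
  ≡⇒≈ {x} eq = mod-L (subst (_∈ L) (trans (sym (invˡ (proj₁ x))) (cong (inv (proj₁ x) ·_) eq)) (e∈ L-sub))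

  ≈-refl : ∀ {x} → x ≈ x
  ≈-refl = ≡⇒≈ refl

  ≈-sym : ∀ {x y} → x ≈ y → y ≈ x
  ≈-sym {x , _} {y , _} (mod-L p) = mod-L (subst (_∈ L)
    (solve (lookup (x ∷ y ∷ [])) ((v 0F ⁻ ∙ v 1F) ⁻) (v 1F ⁻ ∙ v 0F) refl) (inv∈ L-sub p))

  ≈-trans : ∀ {x y z} → x ≈ y → y ≈ z → x ≈ z
  ≈-trans {x , _} {y , _} {z , _} (mod-L p) (mod-L q) = mod-L (subst (_∈ L)
    (solve (lookup (x ∷ y ∷ z ∷ [])) ((v 0F ⁻ ∙ v 1F) ∙ (v 1F ⁻ ∙ v 2F)) (v 0F ⁻ ∙ v 2F) refl) (·∈ L-sub p q))

  A : AbelianGroup 0ℓ 0ℓ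
  A = record
    { Carrier = Carrier
    ; _≈_ = _≈_
    ; _∙_ = λ { (x , p) (y , q) → x · y , ·∈ Z-sub p q }
    ; ε = e , e∈ Z-sub
    ; _⁻¹ = λ { (x , p) → inv x , inv∈ Z-sub p }
    ; isAbelianGroup = record
      { isGroup = record
        { isMonoid = record
          { isSemigroup = record
            { isMagma = record
              { isEquivalence = record { refl = ≈-refl ; sym = ≈-sym ; trans = ≈-trans }
              ; ∙-cong = λ { {x , _} {x′ , _} {y , yZ} {y′ , _} (mod-L p) (mod-L q) → mod-L (subst (_∈ L)
                  (solve (lookup (x ∷ x′ ∷ y ∷ y′ ∷ []))
                    (conjE (v 0F ⁻ ∙ v 1F) (v 2F) ∙ (v 2F ⁻ ∙ v 3F)) ((v 0F ∙ v 2F) ⁻ ∙ (v 1F ∙ v 3F)) refl)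
                  (·∈ L-sub (L^Z p yZ) q)) } }
            ; assoc = λ x y z → ≡⇒≈ (assoc _ _ _) }
          ; identity = (λ _ → ≡⇒≈ (idˡ _)) , (λ _ → ≡⇒≈ (idʳ _)) }
        ; inverse = (λ _ → ≡⇒≈ (invˡ _)) , (λ _ → ≡⇒≈ (invʳ _))
        ; ⁻¹-cong = λ { {x , _} {y , yZ} (mod-L p) → mod-L (subst (_∈ L)
            (solve (lookup (x ∷ y ∷ [])) (conjE ((v 0F ⁻ ∙ v 1F) ⁻) (v 1F ⁻)) ((v 0F ⁻) ⁻ ∙ v 1F ⁻) refl)
            (L^Z (inv∈ L-sub p) (inv∈ Z-sub yZ))) } }
      ; comm = λ { (x , xZ) (y , yZ) → mod-L (subst (_∈ L)
            (solve (lookup (x ∷ y ∷ [])) (commE (v 1F) (v 0F)) ((v 0F ∙ v 1F) ⁻ ∙ (v 1F ∙ v 0F)) refl)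
            (abelian yZ xZ)) } } }

  open AbelianGroup A using () renaming (ε to 0#)
  open import Algebra.Properties.CommutativeMonoid.Mult (AbelianGroup.commutativeMonoid A) using () renaming (_×_ to _⋆_)

  τ : Carrier → Carrier
  τ (x , p) = x ^ t , Z-inv p

  τ-cong : ∀ {x y} → x ≈ y → τ x ≈ τ y
  τ-cong {x , _} {y , _} (mod-L p) = mod-L (subst (_∈ L)
    (solve (lookup (x ∷ y ∷ t ∷ [])) (conjE (v 0F ⁻ ∙ v 1F) (v 2F)) (conjE (v 0F) (v 2F) ⁻ ∙ conjE (v 1F) (v 2F)) refl)
    (L-inv p))

  open Isolation A τ τ-cong (λ x y → ≡⇒≈ (·-^ (proj₁ x) (proj₁ y) t))

  proj₁-iter : ∀ n x → proj₁ (iter n x) ≡ proj₁ x ^ (t ^^ n)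
  proj₁-iter zero    x = sym (^-e _)
  proj₁-iter (suc n) x = trans (cong (_^ t) (proj₁-iter n x))
    (trans (sym (^-· (proj₁ x) (t ^^ n) t)) (cong (proj₁ x ^_) (pow-comm t n)))

  fixed⇒comm : ∀ n x → iter n x ≈ x → comm (proj₁ x) (t ^^ n) ∈ L
  fixed⇒comm n x h = subst (_∈ L) (trans (cong (inv (proj₁ x) ·_) (proj₁-iter n x)) (sym (comm-def _ _))) (quotient (≈-sym h))

  comm⇒fixed : ∀ n x → comm (proj₁ x) (t ^^ n) ∈ L → iter n x ≈ x
  comm⇒fixed n x h = ≈-sym (mod-L (subst (_∈ L) (sym (trans (cong (inv (proj₁ x) ·_) (proj₁-iter n x)) (sym (comm-def _ _)))) h))

  ∈L⇒≈0 : ∀ x → proj₁ x ∈ L → x ≈ 0#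
  ∈L⇒≈0 (x , _) p = mod-L (subst (_∈ L) (sym (idʳ _)) (inv∈ L-sub p))

  ≈0⇒∈L : ∀ x → x ≈ 0# → proj₁ x ∈ L
  ≈0⇒∈L (x , _) (mod-L p) = subst (_∈ L) (solve (lookup (x ∷ [])) ((v 0F ⁻ ∙ ε) ⁻) (v 0F) refl) (inv∈ L-sub p)

  a : Carrier
  a = proj₁ nontrivial , proj₁ (proj₂ nontrivial)

  a≉0 : ¬ (a ≈ 0#)
  a≉0 h = proj₂ (proj₂ nontrivial) (≈0⇒∈L a h)

  proj₁-⋆ : ∀ n x → proj₁ (n ⋆ x) ≡ proj₁ x ^^ n
  proj₁-⋆ zero    x = refl
  proj₁-⋆ (suc n) x = cong (proj₁ x ·_) (proj₁-⋆ n x)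

  -- The period is the least positive exponent for which the power of t acts trivially. It is not 1,
  -- since t does not fix the nonzero element a. Below it, minimality rules out the first case of
  -- `dichotomy`, and the second is freeness.
  exists-period : ∃ λ k → (∀ x → iter (2 + k) x ≈ x) ×
                          (∀ i → 0 < i → i < 2 + k → ∀ x → iter i x ≈ x → x ≈ 0#)
  exists-period with finite-order t
  ... | j , j<m , tj≡e with least (λ n → ∀∈? Z (λ x → comm x (t ^^ suc n) ∈? L)) j
                         (λ x _ → subst (λ z → comm x z ∈ L) (sym tj≡e)
                           (subst (_∈ L) (solve (lookup (x ∷ [])) ε (commE (v 0F) ε) refl) (e∈ L-sub)))
  ...   | zero , _ , all , _ = ⊥-elim (proj₂ (proj₂ nontrivial)
            (fixed (proj₂ a) (subst (λ z → comm (proj₁ a) z ∈ L) (idʳ t) (all _ (proj₂ a)))))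
  ...   | suc k , k≤j , all , min = k , (λ x → comm⇒fixed (2 + k) x (all _ (proj₂ x))) , free
    where
    free : ∀ i → 0 < i → i < 2 + k → ∀ x → iter i x ≈ x → x ≈ 0#
    free (suc i) _ (s≤s i<k) x h with dichotomy (fromℕ< i<m) | Fin.toℕ-fromℕ< i<m
      where
      i<m : suc i < suc m
      i<m = s≤s (≤-trans i<k (≤-trans k≤j (<⇒≤ j<m)))
    ... | inj₁ trivial | eq = ⊥-elim (min i i<k λ y yZ → subst (λ z → comm y (t ^^ z) ∈ L) eq (trivial y yZ))
    ... | inj₂ inj     | eq = ∈L⇒≈0 x (inj _ (proj₂ x) (subst (λ z → comm (proj₁ x) (t ^^ z) ∈ L) (sym eq) (fixed⇒comm (suc i) x h)))

  exists-order : ∃ λ h → (2 + h) ⋆ a ≈ 0# × (∀ i → i < suc h → ¬ (suc i ⋆ a ≈ 0#))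
  exists-order with finite-order (proj₁ a)
  ... | j , _ , aj≡e with least (λ n → (proj₁ a ^^ suc n) ∈? L) j (subst (_∈ L) (sym aj≡e) (e∈ L-sub))
  ...   | zero , _ , aL , _ = ⊥-elim (proj₂ (proj₂ nontrivial) (subst (_∈ L) (idʳ _) aL))
  ...   | suc h , _ , ahL , min = h , ∈L⇒≈0 _ (subst (_∈ L) (sym (proj₁-⋆ (2 + h) a)) ahL) ,
          λ i lt eq → min i lt (subst (_∈ L) (proj₁-⋆ (suc i) a) (≈0⇒∈L (suc i ⋆ a) eq))

  module _ {r : ℕ} where

    mult : Fin r → List (Fin r) → ℕ
    mult i [] = 0
    mult i (j ∷ es) with i Fin.≟ j
    ... | yes _ = suc (mult i es)
    ... | no _  = mult i es

    dot-bump : ∀ i es σ → dot es (bump i σ) ≡ mult i es + dot es σ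
    dot-bump i [] σ = refl
    dot-bump i (j ∷ es) σ with i Fin.≟ j
    ... | yes _ = cong suc (trans (cong (σ j +_) (dot-bump i es σ)) (x∙yz≈y∙xz (σ j) (mult i es) (dot es σ)))
    ... | no _ = trans (cong (σ j +_) (dot-bump i es σ)) (x∙yz≈y∙xz (σ j) (mult i es) (dot es σ))

    -- With b = e the product reads off the counters alone; comparing it with b = a leaves the sum
    -- over the occurrences of c.
    assignment : Fin m → List (Fin r) → Fin (suc r) → Fin m
    assignment b es zero    = b
    assignment b es (suc i) = t ^^ mult i es

    prod-counters : ∀ es W σ → prod G (assignment e es) W · t ^^ dot es σ ≡ t ^^ dot es (run W σ)
    prod-counters es []          σ = idˡ _
    prod-counters es (zero ∷ W)  σ = trans (cong (_· _) (idˡ _)) (prod-counters es W σ)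
    prod-counters es (suc i ∷ W) σ = begin
      (t ^^ mult i es · prod G (assignment e es) W) · t ^^ dot es σ ≡⟨ assoc _ _ _ ⟩
      t ^^ mult i es · (prod G (assignment e es) W · t ^^ dot es σ) ≡⟨ cong (t ^^ mult i es ·_) (prod-counters es W σ) ⟩
      t ^^ mult i es · t ^^ dot es (run W σ)                        ≡⟨ pow-+ t (mult i es) _ ⟨
      t ^^ (mult i es + dot es (run W σ))                           ≡⟨ cong (t ^^_) (dot-bump i es (run W σ)) ⟨
      t ^^ dot es (bump i (run W σ))                                ∎
      where open ≡-Reasoning

    module _ (k : ℕ) (period : ∀ x → iter (2 + k) x ≈ x)
      (free : ∀ i → 0 < i → i < 2 + k → ∀ x → iter i x ≈ x → x ≈ 0#) where

      sum-c : List (Fin r) → List (Fin (suc r)) → Counters → Carrier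
      sum-c es = total (suc k) period free a (ψ (suc k) period free a es [])

      -- Moving the powers of t to the left past an occurrence of c conjugates its value a by
      -- t^(e·s), s being the state at that occurrence. The factor t^(e·σ) accounts for the initial
      -- state.
      prod-total : ∀ es W σ →
        prod G (assignment (proj₁ a) es) W · t ^^ dot es σ ≡ t ^^ dot es (run W σ) · proj₁ (sum-c es W σ)
      prod-total es []          σ = trans (idˡ _) (sym (idʳ _))
      prod-total es (suc i ∷ W) σ = begin
        (t ^^ mult i es · prod G (assignment (proj₁ a) es) W) · t ^^ dot es σ ≡⟨ assoc _ _ _ ⟩
        t ^^ mult i es · (prod G (assignment (proj₁ a) es) W · t ^^ dot es σ) ≡⟨ cong (t ^^ mult i es ·_) (prod-total es W σ) ⟩
        t ^^ mult i es · (t ^^ dot es (run W σ) · proj₁ (sum-c es W σ))       ≡⟨ assoc _ _ _ ⟨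
        (t ^^ mult i es · t ^^ dot es (run W σ)) · proj₁ (sum-c es W σ)       ≡⟨ cong (_· _) (pow-+ t (mult i es) _) ⟨
        t ^^ (mult i es + dot es (run W σ)) · proj₁ (sum-c es W σ)            ≡⟨ cong (λ n → t ^^ n · _) (dot-bump i es (run W σ)) ⟨
        t ^^ dot es (bump i (run W σ)) · proj₁ (sum-c es W σ)                 ∎
        where open ≡-Reasoning
      prod-total es (zero ∷ W)  σ = begin
        (proj₁ a · prod G (assignment (proj₁ a) es) W) · t ^^ dot es σ ≡⟨ assoc _ _ _ ⟩
        proj₁ a · (prod G (assignment (proj₁ a) es) W · t ^^ dot es σ) ≡⟨ cong (proj₁ a ·_) (prod-total es W σ) ⟩
        proj₁ a · (T · X)                                             ≡⟨ solve (lookup (proj₁ a ∷ T ∷ X ∷ []))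
             (v 0F ∙ (v 1F ∙ v 2F)) (v 1F ∙ (conjE (v 0F) (v 1F) ∙ v 2F)) refl ⟩
        T · (proj₁ a ^ T · X)                                         ≡⟨ cong (λ z → T · (z · X)) (proj₁-iter (dot es (run W σ)) a) ⟨
        T · (proj₁ (iter (dot es (run W σ)) a) · X)                   ∎
        where
        open ≡-Reasoning
        T = t ^^ dot es (run W σ)
        X = proj₁ (sum-c es W σ)

      module _ (W W′ : List (Fin (suc r))) (law : ∀ g → prod G g W ≡ prod G g W′) where

        counters-agree : ∀ es σ → t ^^ dot es (run W σ) ≡ t ^^ dot es (run W′ σ)
        counters-agree es σ = trans (sym (prod-counters es W σ))
          (trans (cong (_· _) (law (assignment e es))) (prod-counters es W′ σ))

        totals-agree : ∀ es σ → sum-c es W σ ≈ sum-c es W′ σ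
        totals-agree es σ = ≡⇒≈ (cancel (begin
          t ^^ dot es (run W σ) · proj₁ (sum-c es W σ)         ≡⟨ prod-total es W σ ⟨
          prod G (assignment (proj₁ a) es) W · t ^^ dot es σ   ≡⟨ cong (_· _) (law (assignment (proj₁ a) es)) ⟩
          prod G (assignment (proj₁ a) es) W′ · t ^^ dot es σ  ≡⟨ prod-total es W′ σ ⟩
          t ^^ dot es (run W′ σ) · proj₁ (sum-c es W′ σ)       ≡⟨ cong (_· _) (counters-agree es σ) ⟨
          t ^^ dot es (run W σ) · proj₁ (sum-c es W′ σ)        ∎))
          where open ≡-Reasoning

        -- The exponent vector with a single entry 1 yields equal powers of t. They act equally on
        -- a, whose orbit under τ has full length 2 + k.
        run-agree : ∀ σ i → run W σ i % (2 + k) ≡ run W′ σ i % (2 + k)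
        run-agree σ i = subst₂ (λ p q → p % (2 + k) ≡ q % (2 + k)) (+-identityʳ (run W σ i)) (+-identityʳ (run W′ σ i))
          (orbit-period (suc k) period free {dot (i ∷ []) (run W σ)} {dot (i ∷ []) (run W′ σ)} {a}
            (≡⇒≈ (trans (proj₁-iter (dot (i ∷ []) (run W σ)) a)
              (trans (cong (proj₁ a ^_) (counters-agree (i ∷ []) σ))
                (sym (proj₁-iter (dot (i ∷ []) (run W′ σ)) a))))) a≉0)

        hits-agree : ∀ u → u < 2 + k → ∀ σ → hits (2 + k) u W σ ⋆ a ≈ hits (2 + k) u W′ σ ⋆ a
        hits-agree u u<k σ = hits-determined (suc k) period free a u u<k W W′ σ (λ es → totals-agree es σ)

  isolates : ∃ λ k → ∃ λ h → Isolates G k h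
  isolates with exists-period | exists-order
  ... | k , period , free | h , h⋆a , min = k , h , λ r W W′ law σ →
    run-agree k period free W W′ law σ ,
    λ u u<k → Multiples.order A a (suc h) h⋆a min {hits (2 + k) u W σ} {hits (2 + k) u W′ σ}
      (hits-agree k period free W W′ law u u<k σ)

¬nilpotent⇒isolates : ∀ {m} (G : FinGroup m) → ¬ FinGroup.Nilpotent G → ∃ λ k → ∃ λ h → Isolates G k h
¬nilpotent⇒isolates G ¬nil with NonNilpotent.¬nilpotent⇒irreducible G ¬nil
... | Z , L , t , I = Section.isolates G I

-- Identities of C

-- In C and in the models every term t denotes the pair of the first component of its
-- first variable, and the word wordOf t acting on the second component of its last variable.
headVar lastVar : ∀ {n} → Term n → Fin n
headVar (var i)  = i
headVar (f′ t)   = headVar t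
headVar (d′ s t) = headVar s
lastVar (var i)  = i
lastVar (f′ t)   = lastVar t
lastVar (d′ s t) = lastVar t

wordOf : ∀ {n} → Term n → List (Fin n)
wordOf (var i)  = []
wordOf (f′ t)   = headVar t ∷ wordOf t
wordOf (d′ s t) = wordOf t

module Laws {m c : ℕ} (G : FinGroup m) (α : FaithfulAction G c) where
  open FinGroup G using (e)
  open FaithfulAction α

  C : Algebra
  C = algC G α

  eval-C : ∀ {n} (ρ : Fin n → Algebra.Carrier C) t →
    eval C ρ t ≡ (proj₁ (ρ (headVar t)) , foldr (α⁰ α ∘ proj₁ ∘ ρ) (proj₂ (ρ (lastVar t))) (wordOf t))
  eval-C ρ (var i)  = refl
  eval-C ρ (f′ t)   rewrite eval-C ρ t = refl
  eval-C ρ (d′ s t) rewrite eval-C ρ s | eval-C ρ t = refl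

  module _ {n} (s t : Term n) (law : C ⊨ s ≈ t) where

    headVar-≡ : headVar s ≡ headVar t
    headVar-≡ = decidable-stable (headVar s Fin.≟ headVar t) λ ne →
      separate ne (trans (sym (cong proj₁ (eval-C ρ s))) (trans (cong proj₁ (law ρ)) (cong proj₁ (eval-C ρ t))))
      where
      γ : Fin n → Maybe (Fin m)
      γ i with i Fin.≟ headVar s
      ... | yes _ = just e
      ... | no _  = nothing
      ρ : Fin n → Algebra.Carrier C
      ρ i = γ i , nothing
      separate : ¬ (headVar s ≡ headVar t) → ¬ (γ (headVar s) ≡ γ (headVar t))
      separate ne eq with headVar s Fin.≟ headVar s | headVar t Fin.≟ headVar s
      separate ne () | yes _ | no _
      ... | _     | yes p = ne (sym p)
      ... | no q  | _     = q refl

    second-≡ : ∀ ρ → foldr (α⁰ α ∘ proj₁ ∘ ρ) (proj₂ (ρ (lastVar s))) (wordOf s) ≡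
                     foldr (α⁰ α ∘ proj₁ ∘ ρ) (proj₂ (ρ (lastVar t))) (wordOf t)
    second-≡ ρ = trans (sym (cong proj₂ (eval-C ρ s))) (trans (cong proj₂ (law ρ)) (cong proj₂ (eval-C ρ t)))

    fold-just : (g : Fin n → Fin m) (z : Fin c) (w : List (Fin n)) →
      foldr (α⁰ α ∘ just ∘ g) (just z) w ≡ just (act (prod G g w) z)
    fold-just g z []      = cong just (sym (act-id z))
    fold-just g z (i ∷ w) rewrite fold-just g z w = cong just (sym (act-comp (g i) (prod G g w) z))

    fold-nothing : (g : Fin n → Fin m) (w : List (Fin n)) → foldr (α⁰ α ∘ just ∘ g) nothing w ≡ nothing
    fold-nothing g []      = refl
    fold-nothing g (i ∷ w) rewrite fold-nothing g w = refl

    -- With all group elements set to e the words fix every point of S, and a point z against 0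
    -- tells the last variables apart.
    lastVar-≡ : Fin c → lastVar s ≡ lastVar t
    lastVar-≡ z = decidable-stable (lastVar s Fin.≟ lastVar t) λ ne → separate ne (second-≡ ρ)
      where
      ξ : Fin n → Maybe (Fin c)
      ξ i with i Fin.≟ lastVar s
      ... | yes _ = just z
      ... | no _  = nothing
      ρ : Fin n → Algebra.Carrier C
      ρ i = just e , ξ i
      separate : ¬ (lastVar s ≡ lastVar t) →
        ¬ (foldr (α⁰ α ∘ just ∘ λ _ → e) (ξ (lastVar s)) (wordOf s) ≡ foldr (α⁰ α ∘ just ∘ λ _ → e) (ξ (lastVar t)) (wordOf t))
      separate ne eq with lastVar s Fin.≟ lastVar s | lastVar t Fin.≟ lastVar s
      ... | _     | yes p = ne (sym p)
      ... | no q  | _     = q refl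
      ... | yes _ | no _ with trans (sym (fold-just (λ _ → e) z (wordOf s))) (trans eq (fold-nothing (λ _ → e) (wordOf t)))
      ...   | ()

    prod-≡ : ∀ g → prod G g (wordOf s) ≡ prod G g (wordOf t)
    prod-≡ g = faithful _ _ λ z → just-injective
      (trans (sym (fold-just g z (wordOf s))) (trans (second-≡ (λ i → just (g i) , just z)) (fold-just g z (wordOf t))))

  -- A faithful action on the empty set makes G trivial, hence nilpotent.
  nonempty : ¬ FinGroup.Nilpotent G → Fin c
  nonempty ¬nil = element c refl
    where
    element : ∀ c′ → c′ ≡ c → Fin c
    element (suc c′) refl = zero
    element zero     refl = ⊥-elim (¬nil (0 , λ x → faithful x e λ ()))

-- The models satisfy the identities of C in n variables

not-surjective : ∀ {n} (φ : Fin n → Fin (suc n)) → ∃ λ l → ∀ i → ¬ (φ i ≡ l)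
not-surjective {n} φ with Fin.any? (λ l → Fin.all? (λ i → ¬? (φ i Fin.≟ l)))
... | yes p = p
... | no ¬p = ⊥-elim (<⇒≱ (n<1+n n) (Fin.injective⇒≤ {f = λ l → proj₁ (preimage l)}
    λ {l} {l′} eq → trans (sym (proj₂ (preimage l))) (trans (cong φ eq) (proj₂ (preimage l′)))))
  where
  preimage : ∀ l → ∃ λ i → φ i ≡ l
  preimage l with Fin.any? (λ i → φ i Fin.≟ l)
  ... | yes q = q
  ... | no ¬q = ⊥-elim (¬p (l , λ i eq → ¬q (i , eq)))

prod-map : ∀ {m n n′} (G : FinGroup m) (g : Fin n′ → Fin m) (φ : Fin n → Fin n′) w →
           prod G g (map φ w) ≡ prod G (g ∘ φ) w
prod-map G g φ []      = refl
prod-map G g φ (i ∷ w) = cong (FinGroup._·_ G (g (φ i))) (prod-map G g φ w)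

module _ {m c : ℕ} (G : FinGroup m) (α : FaithfulAction G c) {k h : ℕ} (iso : Isolates G k h) (z : Fin c) (n ℓ : ℕ) where
  open Model n ℓ k h
  open Laws G α

  eval-model : (ρ : Fin n → Algebra.Carrier model) (t : Term n) →
    eval model ρ t ≡ (proj₁ (ρ (headVar t)) , acts (map (proj₁ ∘ ρ) (wordOf t)) (proj₂ (ρ (lastVar t))))
  eval-model ρ (var i)  = refl
  eval-model ρ (f′ t)   rewrite eval-model ρ t = refl
  eval-model ρ (d′ s t) rewrite eval-model ρ s | eval-model ρ t = refl

  -- The n variables take values in at most n of the n + 1 letters.
  model-InVn : InVn n C model
  model-InVn s t law ρ with not-surjective (proj₁ ∘ ρ)
  ... | l , missing = begin
    eval model ρ s                                      ≡⟨ eval-model ρ s ⟩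
    proj₁ (ρ (headVar s)) , acts W (proj₂ (ρ (lastVar s)))  ≡⟨ cong₂ (λ i j → proj₁ (ρ i) , acts W (proj₂ (ρ j)))
                                                            (headVar-≡ s t law) (lastVar-≡ s t law z) ⟩
    proj₁ (ρ (headVar t)) , acts W (proj₂ (ρ (lastVar t)))  ≡⟨ cong (proj₁ (ρ (headVar t)) ,_) agree ⟩
    proj₁ (ρ (headVar t)) , acts W′ (proj₂ (ρ (lastVar t))) ≡⟨ eval-model ρ t ⟨
    eval model ρ t                                      ∎
    where
    open ≡-Reasoning
    W = map (proj₁ ∘ ρ) (wordOf s)
    W′ = map (proj₁ ∘ ρ) (wordOf t)
    l∉ : ∀ w → l ∉ᴸ map (proj₁ ∘ ρ) w
    l∉ w p with ∈-map⁻ (proj₁ ∘ ρ) p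
    ... | i , _ , eq = missing i (sym eq)
    b = proj₂ (ρ (lastVar t))
    counts = iso n W W′ (λ g → trans (prod-map G g (proj₁ ∘ ρ) (wordOf s))
      (trans (prod-≡ s t law (g ∘ proj₁ ∘ ρ)) (sym (prod-map G g (proj₁ ∘ ρ) (wordOf t))))) (counters (proj₂ b))
    agree : acts W b ≡ acts W′ b
    agree = acts-determined W W′ (proj₁ b) (proj₂ b) l (l∉ (wordOf s)) (l∉ (wordOf t)) (proj₁ counts) (proj₂ counts)

-- Transport to carriers of the form `Fin N`

module Transport (B : Algebra) {N : ℕ} (φ : Algebra.Carrier B ↔ Fin N) where
  open Algebra B
  open Inverse φ using (to; from; strictlyInverseˡ; strictlyInverseʳ)

  F : Fin N → Fin N
  F x = to (f (from x))

  D′ : Fin N → Fin N → Fin N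
  D′ x y = to (d (from x) (from y))

  eval-transport : ∀ {n} (ρ : Fin n → Fin N) t → eval (finAlg N F D′) ρ t ≡ to (eval B (from ∘ ρ) t)
  eval-transport ρ (var i)  = sym (strictlyInverseˡ (ρ i))
  eval-transport ρ (f′ t)   = cong (to ∘ f) (trans (cong from (eval-transport ρ t)) (strictlyInverseʳ _))
  eval-transport ρ (d′ s t) = cong₂ (λ x y → to (d x y))
    (trans (cong from (eval-transport ρ s)) (strictlyInverseʳ _))
    (trans (cong from (eval-transport ρ t)) (strictlyInverseʳ _))

  InVn-transport : ∀ {n A} → InVn n A B → InVn n A (finAlg N F D′)
  InVn-transport h s t law ρ = trans (eval-transport ρ s)
    (trans (cong to (h s t law (from ∘ ρ))) (sym (eval-transport ρ t)))

  GeneratedBy-transport : ∀ {dd} {gens : Fin dd → Carrier} → GeneratedBy B gens → GeneratedBy (finAlg N F D′) (to ∘ gens)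
  GeneratedBy-transport gen P Pg Pf Pd b = subst P (strictlyInverseˡ b) (gen (P ∘ to) Pg
    (λ x p → subst (P ∘ to ∘ f) (strictlyInverseʳ x) (Pf (to x) p))
    (λ x y p q → subst₂ (λ x y → P (to (d x y))) (strictlyInverseʳ x) (strictlyInverseʳ y) (Pd (to x) (to y) p q))
    (from b))

finite-copy : ∀ (B A : Algebra) {N n dd ℓ} → Algebra.Carrier B ↔ Fin N → (column : Fin ℓ → Algebra.Carrier B) →
  (∀ {i j} → column i ≡ column j → i ≡ j) → InVn n A B → (gens : Fin dd → Algebra.Carrier B) → GeneratedBy B gens →
  Σ ℕ λ N → ℓ ≤ N × (Σ (Fin N → Fin N) λ fo → Σ (Fin N → Fin N → Fin N) λ dO →
    InVn n A (finAlg N fo dO) × Σ (Fin dd → Fin N) λ gens → GeneratedBy (finAlg N fo dO) gens)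
finite-copy B A {N} φ column inj inV gens gen =
  N , Fin.injective⇒≤ {f = to ∘ column} (λ {i} {j} eq → inj
        (trans (sym (strictlyInverseʳ (column i))) (trans (cong from eq) (strictlyInverseʳ (column j))))) ,
  F , D′ , InVn-transport {A = A} inV , to ∘ gens , GeneratedBy-transport gen
  where
  open Inverse φ using (to; from; strictlyInverseʳ)
  open Transport B φ

theorem5p2 : (m k : ℕ) (G : FinGroup m) (α : FaithfulAction G k) →
    ¬ FinGroup.Nilpotent G →
    (n : ℕ) → 1 ≤ n → Σ ℕ λ dd → 1 ≤ dd × ArbLargeFinGen n (algC G α) dd
-- There is one generator for each letter: c and as many counters as there are variables.
theorem5p2 m c G α ¬nil (suc n) _ = 2 + n , s≤s z≤n , λ ℓ →
  let open Model (suc n) ℓ k h in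
  finite-copy model (algC G α) (proj₂ model↔Fin)
    -- One cell in each of ℓ of the ℓ + 1 columns gives ℓ distinct elements.
    (λ j → zero , (inject₁ j , zero) , replicate (suc n) zero)
    (λ eq → Fin.inject₁-injective (cong (proj₁ ∘ proj₁ ∘ proj₂) eq))
    (model-InVn G α iso (Laws.nonempty G α ¬nil) (suc n) ℓ)
    generators (generated zero)
  where
  isolation : ∃ λ k → ∃ λ h → Isolates G k h
  isolation = ¬nilpotent⇒isolates G ¬nil
  k h : ℕ
  k = proj₁ isolation
  h = proj₁ (proj₂ isolation)
  iso : Isolates G k h
  iso = proj₂ (proj₂ isolation)
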